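{- For every positive integer $k$ and every real $\varepsilon>0$ there exists $N=N(k,\varepsilon)$ such that every Hamiltonian graph $G$ on $n\ge N$ vertices with minimum degree $\delta(G)\ge \varepsilon n$ has a $2$-factor consisting of exactly $k$ cycles.
   Context: Graphs are finite and simple. A $2$-factor of $G$ is a spanning $2$-regular subgraph of $G$, i.e. a collection of vertex-disjoint cycles covering all vertices of $G$. -}

module Defs where

open import Data.Nat using (ℕ; zero; suc; _≤_)
open import Data.Bool using (Bool; true; false; T; if_then_else_)
open import Data.Fin using (Fin)
open import Data.List using (List; []; _∷_; _++_; length; map; concat; allFin)
open import Data.Nat.ListAction using (sum)
open import Data.List.Relation.Unary.Unique.Propositional using (Unique)
open import Data.List.Relation.Binary.Permutation.Propositional using (_↭_)
open import Data.Vec using (Vec; toList)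
open import Data.Vec.Relation.Unary.All using (All)
open import Data.Unit using (⊤)
open import Data.Empty using (⊥)
open import Data.Product using (_×_; Σ)
open import Relation.Binary.PropositionalEquality using (_≡_)

record Graph (n : ℕ) : Set where
  field
    adj   : Fin n → Fin n → Bool
    sym   : ∀ u v → adj u v ≡ adj v u
    irrefl : ∀ v → adj v v ≡ false

module _ {n : ℕ} (G : Graph n) where
  open Graph G

  Adj : Fin n → Fin n → Set
  Adj u v = T (adj u v)

  deg : Fin n → ℕ
  deg v = sum (map (λ u → if adj v u then 1 else 0) (allFin n))

  ConsecAdj : List (Fin n) → Set
  ConsecAdj [] = ⊤
  ConsecAdj (x ∷ []) = ⊤
  ConsecAdj (x ∷ y ∷ r) = Adj x y × ConsecAdj (y ∷ r)

  IsCycle : List (Fin n) → Set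
  IsCycle [] = ⊥
  IsCycle (v ∷ vs) = 2 ≤ length vs × Unique (v ∷ vs) × ConsecAdj (v ∷ vs ++ v ∷ [])

  Hamiltonian : Set
  Hamiltonian = Σ (List (Fin n)) λ c → IsCycle c × (c ↭ allFin n)

  -- a 2-factor of G consisting of exactly k cycles: k cycles of G that are
  -- vertex-disjoint and together cover every vertex (each exactly once)
  TwoFactorWith : ℕ → Set
  TwoFactorWith k = Σ (Vec (List (Fin n)) k) λ cs →
    All IsCycle cs × (concat (toList cs) ↭ allFin n)

{-# OPTIONS --safe #-}
module Submission where

-- Let h₀ h₁ … be the Hamilton cycle. Call positions p, q red-adjacent if h p ~ h q and
-- blue-adjacent if h (p+1) ~ h (q+1); both graphs are dense. Cutting the cycle after the
-- positions of a set S and rejoining the ends along a red and a blue perfect matching of S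
-- gives again a 2-factor.
--
-- A random pair of constant-size tuples u, v satisfies with probability ≥ 1/2 that every uᵢ
-- has a red neighbour in v and every vⱼ a blue one in u. Fixing the pattern of these
-- neighbours and applying Erdős' theorem on complete multipartite hypergraphs blows the pattern
-- up to clusters; following it gives a closed alternating walk of clusters, of bounded length.
--
-- Go round this walk k times and choose at every visit two positions p < q of the cluster, all
-- these pairs lying in disjoint intervals. The arcs h (p+1) … h q of one round close up to a
-- cycle, which yields k cycles; each of them uses an edge of every class of the walk. The arcs
-- left over can be concatenated along edges of the classes until both ends of each lie in the two
-- sides of one class, and then be inserted in the first cycle at its edge of that class.

open import Defs
open import Data.Nat using (ℕ; zero; suc; z≤n; s≤s; _≥_; NonZero; >-nonZero)
open import Data.Nat.ListAction using (sum)
open import Data.Nat.Solver using (module +-*-Solver)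
open import Data.Bool using (Bool; true; false; T; not; _∧_; _∨_; if_then_else_)
open import Data.Bool.ListAction using (all)
open import Data.Bool.Properties using (T-∧; T-∨)
open import Data.Fin using (Fin; zero; suc; toℕ)
open import Data.Fin.Properties using (pigeonhole; toℕ<n)
open import Data.List using (List; []; _∷_; _++_; length; map; take; reverse; replicate; concat; concatMap; cartesianProduct; cartesianProductWith; allFin)
open import Data.List.Properties using (length-++; length-map; length-take; length-tabulate; unfold-reverse; ++-assoc; ++-identityʳ; concatMap-++; map-∘; map-id; ∷-injective)
open import Data.List.Membership.Propositional using (_∈_)
open import Data.List.Membership.Propositional.Properties using (∈-++⁺ˡ; ∈-++⁺ʳ; ∈-++⁻; ∈-map⁺; ∈-map⁻; ∈-cartesianProductWith⁺; ∈-cartesianProduct⁺; ∈-allFin)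
open import Data.List.Relation.Unary.Any using (here; there)
open import Data.List.Relation.Unary.All as All using (All; []; _∷_)
import Data.List.Relation.Unary.All.Properties as AllP
open import Data.List.Relation.Unary.AllPairs using (AllPairs; []; _∷_)
open import Data.List.Relation.Unary.Unique.Propositional using (Unique)
open import Data.List.Relation.Unary.Unique.Propositional.Properties using (allFin⁺)
open import Data.List.Relation.Binary.Sublist.Propositional using (_⊆_; []; _∷_; _∷ʳ_; ⊆-trans; minimum)
open import Data.List.Relation.Binary.Sublist.Propositional.Properties using (take-⊆; All-resp-⊆)
open import Data.List.Relation.Binary.Permutation.Propositional using (_↭_; ↭-refl; ↭-sym; ↭-trans; ↭-reflexive; prep; swap; ↭⇒↭ₛ; module PermutationReasoning)
open import Data.List.Relation.Binary.Permutation.Propositional.Properties using (map⁺; ++⁺; ++⁺ˡ; ++⁺ʳ; ++-comm; ↭-reverse; shifts; ∷↭∷ʳ; drop-∷; ∈-resp-↭; All-resp-↭; ↭-map-inv; ↭-empty-inv; ↭-length)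
open import Data.List.Relation.Binary.Permutation.Setoid.Properties using (Unique-resp-↭)
open import Data.Vec using (Vec; []; _∷_; toList; lookup; splitAt) renaming (_++_ to _++ᵛ_)
open import Data.Vec.Properties using (length-toList)
open import Data.Vec.Relation.Unary.All as VAll using ([]; _∷_)
import Data.Vec.Relation.Unary.All.Properties as VAllP
open import Data.Vec.Relation.Binary.Pointwise.Inductive as PW using (Pointwise; []; _∷_)
open import Data.Product using (Σ; ∃; _×_; _,_; proj₁; proj₂)
open import Data.Sum using (inj₁; inj₂)
open import Data.Empty using (⊥-elim)
open import Data.Unit using (tt)
open import Function using (_∘_; id; it; Equivalence)
open import Relation.Nullary using (yes; no)
open import Relation.Binary.PropositionalEquality using (_≡_; refl; sym; trans; cong; cong₂; subst; subst₂; setoid; module ≡-Reasoning)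

private variable
  A B C I : Set

-- Finite sums, averaging and the pigeonhole principle

module Density where
  open import Data.Nat using (_+_; _*_; _^_; _≤_; _<_; _≤ᵇ_)
  open import Data.Nat.Properties

  ⟦_⟧ : Bool → ℕ
  ⟦ b ⟧ = if b then 1 else 0

  ⟦⟧≤1 : ∀ b → ⟦ b ⟧ ≤ 1
  ⟦⟧≤1 true  = ≤-refl
  ⟦⟧≤1 false = z≤n

  T⇒⟦⟧ : ∀ {b} → T b → 1 ≤ ⟦ b ⟧
  T⇒⟦⟧ {true} _ = ≤-refl

  ⟦⟧⇒T : ∀ {b} → 0 < ⟦ b ⟧ → T b
  ⟦⟧⇒T {true} _ = tt

  ∑ : List A → (A → ℕ) → ℕ
  ∑ []       f = 0
  ∑ (x ∷ xs) f = f x + ∑ xs f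

  ∑-cong : ∀ (xs : List A) {f g} → (∀ x → f x ≡ g x) → ∑ xs f ≡ ∑ xs g
  ∑-cong []       e = refl
  ∑-cong (x ∷ xs) e = cong₂ _+_ (e x) (∑-cong xs e)

  ∑-mono : ∀ (xs : List A) {f g} → (∀ x → f x ≤ g x) → ∑ xs f ≤ ∑ xs g
  ∑-mono []       e = z≤n
  ∑-mono (x ∷ xs) e = +-mono-≤ (e x) (∑-mono xs e)

  ∑-const : ∀ (xs : List A) c → ∑ xs (λ _ → c) ≡ length xs * c
  ∑-const []       c = refl
  ∑-const (x ∷ xs) c = cong (c +_) (∑-const xs c)

  ∑-length : ∀ (xs : List A) → ∑ xs (λ _ → 1) ≡ length xs
  ∑-length xs = trans (∑-const xs 1) (*-identityʳ _)

  ∑-*ˡ : ∀ (xs : List A) c f → ∑ xs (λ x → c * f x) ≡ c * ∑ xs f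
  ∑-*ˡ []       c f = sym (*-zeroʳ c)
  ∑-*ˡ (x ∷ xs) c f = trans (cong (c * f x +_) (∑-*ˡ xs c f)) (sym (*-distribˡ-+ c (f x) _))

  ∑-*ʳ : ∀ (xs : List A) c f → ∑ xs (λ x → f x * c) ≡ ∑ xs f * c
  ∑-*ʳ xs c f = trans (∑-cong xs (λ x → *-comm (f x) c)) (trans (∑-*ˡ xs c f) (*-comm c _))

  ∑-+ : ∀ (xs : List A) f g → ∑ xs (λ x → f x + g x) ≡ ∑ xs f + ∑ xs g
  ∑-+ []       f g = refl
  ∑-+ (x ∷ xs) f g = trans (cong (f x + g x +_) (∑-+ xs f g)) (lem (f x) (g x) (∑ xs f) (∑ xs g))
    where
    open +-*-Solver
    lem : ∀ a b c d → a + b + (c + d) ≡ a + c + (b + d)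
    lem = solve 4 (λ a b c d → a :+ b :+ (c :+ d) := a :+ c :+ (b :+ d)) refl

  ∑-swap : ∀ (xs : List A) (ys : List B) (f : A → B → ℕ) →
           ∑ xs (λ x → ∑ ys (λ y → f x y)) ≡ ∑ ys (λ y → ∑ xs (λ x → f x y))
  ∑-swap []       ys f = sym (trans (∑-const ys 0) (*-zeroʳ (length ys)))
  ∑-swap (x ∷ xs) ys f = trans (cong (∑ ys (f x) +_) (∑-swap xs ys f)) (sym (∑-+ ys (f x) _))

  ∑-++ : ∀ (xs ys : List A) f → ∑ (xs ++ ys) f ≡ ∑ xs f + ∑ ys f
  ∑-++ []       ys f = refl
  ∑-++ (x ∷ xs) ys f = trans (cong (f x +_) (∑-++ xs ys f)) (sym (+-assoc (f x) _ _))

  ∑-map : ∀ (g : A → B) (xs : List A) f → ∑ (map g xs) f ≡ ∑ xs (λ x → f (g x))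
  ∑-map g []       f = refl
  ∑-map g (x ∷ xs) f = cong (f (g x) +_) (∑-map g xs f)

  ∑-max : ∀ (P : List I) (w : I → ℕ) → 0 < ∑ P w → ∃ λ p → p ∈ P × ∑ P w ≤ length P * w p
  ∑-max (x ∷ P) w pos with 1 ≤? ∑ P w
  ... | no none = x , here refl , +-monoʳ-≤ (w x) (≤-trans (≤-reflexive (n<1⇒n≡0 (≰⇒> none))) z≤n)
  ... | yes some with ∑-max P w some
  ...   | p , p∈P , le with ≤-total (w x) (w p)
  ...     | inj₁ x≤p = p , there p∈P , +-mono-≤ x≤p le
  ...     | inj₂ p≤x = x , here refl , +-monoʳ-≤ (w x) (≤-trans le (*-monoʳ-≤ (length P) p≤x))

  -- Double counting of the pairs `(p , y)` with `F p y`: every good `y` occurs in one of them, so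
  -- the `p` occurring most often has at least the average share.
  ∑-pigeonhole : ∀ (P : List I) (Y : List B) (good : B → Bool) (F : I → B → Bool) →
    (∀ y → T (good y) → ∃ λ p → p ∈ P × T (F p y)) → 0 < ∑ Y (⟦_⟧ ∘ good) →
    ∃ λ p → p ∈ P × ∑ Y (⟦_⟧ ∘ good) ≤ length P * ∑ Y (⟦_⟧ ∘ F p)
  ∑-pigeonhole P Y good F cover pos =
    let p , p∈P , le = ∑-max P (λ p → ∑ Y (⟦_⟧ ∘ F p)) (≤-trans pos total)
    in p , p∈P , ≤-trans total le
    where
    member : ∀ {p} {P : List _} {y} → p ∈ P → T (F p y) → 1 ≤ ∑ P (λ p → ⟦ F p y ⟧)
    member (here refl) t = ≤-trans (T⇒⟦⟧ t) (m≤m+n _ _)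
    member (there i)   t = ≤-trans (member i t) (m≤n+m _ _)
    covered : ∀ y → ⟦ good y ⟧ ≤ ∑ P (λ p → ⟦ F p y ⟧)
    covered y with good y in eq
    ... | false = z≤n
    ... | true  = let _ , i , t = cover y (subst T (sym eq) tt) in member i t
    total : ∑ Y (⟦_⟧ ∘ good) ≤ ∑ P (λ p → ∑ Y (⟦_⟧ ∘ F p))
    total = ≤-trans (∑-mono Y covered) (≤-reflexive (∑-swap Y P _))

  -- Common neighbours in dense bipartite graphs

  choose : ℕ → List A → List (List A)
  choose zero    xs       = [] ∷ []
  choose (suc m) []       = []
  choose (suc m) (x ∷ xs) = map (x ∷_) (choose m xs) ++ choose (suc m) xs

  choose-length : ∀ m (xs : List A) → length (choose m xs) ≤ 2 ^ length xs
  choose-length zero    xs       = m^n>0 2 (length xs)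
  choose-length (suc m) []       = z≤n
  choose-length (suc m) (x ∷ xs) = ≤-trans
    (≤-reflexive (trans (length-++ (map (x ∷_) (choose m xs)))
                        (cong (_+ length (choose (suc m) xs)) (length-map (x ∷_) (choose m xs)))))
    (+-mono-≤ (choose-length m xs) (≤-trans (choose-length (suc m) xs) (m≤m+n _ 0)))

  choose-sound : ∀ m (xs : List A) {V} → V ∈ choose m xs → V ⊆ xs × length V ≡ m
  choose-sound zero    xs       (here refl) = minimum xs , refl
  choose-sound (suc m) (x ∷ xs) V∈ with ∈-++⁻ (map (x ∷_) (choose m xs)) V∈
  ... | inj₂ i = let s , l = choose-sound (suc m) xs i in x ∷ʳ s , l
  ... | inj₁ i with ∈-map⁻ (x ∷_) i
  ...   | _ , j , refl = let s , l = choose-sound m xs j in refl ∷ s , cong suc l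

  -- Greedy choice of the first `m` elements satisfying `g`. In this way a vertex with `m`
  -- neighbours can be charged to a whole `m`-element sublist.
  choose-complete : ∀ m (xs : List A) (g : A → Bool) → m ≤ ∑ xs (⟦_⟧ ∘ g) →
                    ∃ λ V → V ∈ choose m xs × T (all g V)
  choose-complete zero    xs       g le = [] , here refl , tt
  choose-complete (suc m) (x ∷ xs) g le with g x in eq
  ... | false = let V , i , t = choose-complete (suc m) xs g le
                in V , ∈-++⁺ʳ (map (x ∷_) (choose m xs)) i , t
  ... | true with choose-complete m xs g (≤-pred le)
  ...   | V , i , t = x ∷ V , ∈-++⁺ˡ (∈-map⁺ (x ∷_) i) , subst (λ b → T (b ∧ all g V)) (sym eq) t

  all⇒T : ∀ (g : A → Bool) {V x} → T (all g V) → x ∈ V → T (g x)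
  all⇒T g {V = v ∷ V} t (here refl) = proj₁ (Equivalence.to (T-∧ {g v}) t)
  all⇒T g {V = v ∷ V} t (there i)   = all⇒T g (proj₂ (Equivalence.to (T-∧ {g v}) t)) i

  -- A reverse Markov inequality: points with `2 * D * w x < c` carry at most half of the guaranteed
  -- total weight and the others at most `c` each, so at least `length X / (2 * D)` points are
  -- heavy.
  heavy : ∀ D c q (X : List A) (w : A → ℕ) → 0 < c → (∀ x → w x ≤ c) →
    length X * c ≤ D * ∑ X w → 2 * D * q < length X →
    ∃ λ Z → Z ⊆ X × length Z ≡ q × All (λ x → c ≤ 2 * D * w x) Z
  heavy {A} D c@(suc _) q X w _ w≤c dense big =
    let Z , s , l = shorten G q (enough (length G) count)
    in  Z , ⊆-trans s (sub X) , l , All-resp-⊆ s (heavies X)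
    where
    keep : List A → List A
    keep []       = []
    keep (x ∷ xs) with c ≤? 2 * D * w x
    ... | yes _ = x ∷ keep xs
    ... | no  _ = keep xs
    sub : ∀ xs → keep xs ⊆ xs
    sub []       = []
    sub (x ∷ xs) with c ≤? 2 * D * w x
    ... | yes _ = refl ∷ sub xs
    ... | no  _ = x ∷ʳ sub xs
    heavies : ∀ xs → All (λ x → c ≤ 2 * D * w x) (keep xs)
    heavies []       = []
    heavies (x ∷ xs) with c ≤? 2 * D * w x
    ... | yes p = p ∷ heavies xs
    ... | no  _ = heavies xs
    G = keep X
    split : ∀ xs → 2 * D * ∑ xs w ≤ 2 * D * c * length (keep xs) + length xs * c
    split []       = ≤-trans (≤-reflexive (*-zeroʳ (2 * D))) z≤n
    split (x ∷ xs) with c ≤? 2 * D * w x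
    ... | yes _ = begin
      2 * D * (w x + ∑ xs w)                              ≡⟨ *-distribˡ-+ (2 * D) (w x) _ ⟩
      2 * D * w x + 2 * D * ∑ xs w                        ≤⟨ +-mono-≤ (*-monoʳ-≤ (2 * D) (w≤c x)) (split xs) ⟩
      2 * D * c + (2 * D * c * length (keep xs) + length xs * c) ≡⟨ +-assoc (2 * D * c) _ _ ⟨
      2 * D * c + 2 * D * c * length (keep xs) + length xs * c   ≡⟨ cong (_+ length xs * c) (*-suc (2 * D * c) _) ⟨
      2 * D * c * suc (length (keep xs)) + length xs * c  ≤⟨ +-monoʳ-≤ (2 * D * c * suc (length (keep xs))) (m≤n+m _ c) ⟩
      2 * D * c * suc (length (keep xs)) + (c + length xs * c) ∎
      where open ≤-Reasoning
    ... | no light = begin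
      2 * D * (w x + ∑ xs w)                              ≡⟨ *-distribˡ-+ (2 * D) (w x) _ ⟩
      2 * D * w x + 2 * D * ∑ xs w                        ≤⟨ +-mono-≤ (<⇒≤ (≰⇒> light)) (split xs) ⟩
      c + (2 * D * c * length (keep xs) + length xs * c)  ≡⟨ lem c (2 * D * c * length (keep xs)) (length xs * c) ⟩
      2 * D * c * length (keep xs) + (c + length xs * c)  ∎
      where
      open ≤-Reasoning
      lem : ∀ a b d → a + (b + d) ≡ b + (a + d)
      lem = solve 3 (λ a b d → a :+ (b :+ d) := b :+ (a :+ d)) refl where open +-*-Solver
    count : length X ≤ 2 * D * length G
    count = *-cancelʳ-≤ (length X) (2 * D * length G) c (+-cancelʳ-≤ (length X * c) _ _ (begin
      length X * c + length X * c             ≡⟨ lem₁ (length X * c) ⟩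
      2 * (length X * c)                      ≤⟨ *-monoʳ-≤ 2 dense ⟩
      2 * (D * ∑ X w)                         ≡⟨ *-assoc 2 D _ ⟨
      2 * D * ∑ X w                           ≤⟨ split X ⟩
      2 * D * c * length G + length X * c     ≡⟨ cong (_+ length X * c) (lem₂ (2 * D) c (length G)) ⟩
      2 * D * length G * c + length X * c     ∎))
      where
      open ≤-Reasoning
      open +-*-Solver
      lem₁ : ∀ a → a + a ≡ 2 * a
      lem₁ = solve 1 (λ a → a :+ a := con 2 :* a) refl
      lem₂ : ∀ a b d → a * b * d ≡ a * d * b
      lem₂ = solve 3 (λ a b d → a :* b :* d := a :* d :* b) refl
    enough : ∀ g → length X ≤ 2 * D * g → q ≤ g
    enough g le with q ≤? g
    ... | yes p = p
    ... | no np = ⊥-elim (<-irrefl refl (≤-trans big (≤-trans le (*-monoʳ-≤ (2 * D) (<⇒≤ (≰⇒> np))))))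
    shorten : ∀ (ys : List A) q → q ≤ length ys → ∃ λ Z → Z ⊆ ys × length Z ≡ q
    shorten ys q le = take q ys , take-⊆ q ys , trans (length-take q ys) (m≤n⇒m⊓n≡m le)

  -- Summed over all points, this bounds a total degree in terms of the number of points of degree
  -- at least `m`.
  threshold : ∀ m q s → s ≤ q → s ≤ q * ⟦ m ≤ᵇ s ⟧ + m
  threshold m q s s≤q with m ≤ᵇ s in eq
  ... | true  = ≤-trans s≤q (≤-trans (≤-reflexive (sym (*-identityʳ q))) (m≤m+n _ m))
  ... | false = ≤-trans (<⇒≤ (≰⇒> λ le → subst T eq (≤⇒≤ᵇ le))) (m≤n+m m _)

  positive-factor : ∀ {c} a R → 0 < c → c ≤ a * R → 0 < R
  positive-factor a zero    c>0 le = ⊥-elim (<-irrefl refl (≤-trans c>0 (≤-trans le (≤-reflexive (*-zeroʳ a)))))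
  positive-factor a (suc R) c>0 le = s≤s z≤n

  ∑-heavy : ∀ c a {Z : List A} (w : A → ℕ) → All (λ x → c ≤ a * w x) Z → length Z * c ≤ a * ∑ Z w
  ∑-heavy c a w []               = z≤n
  ∑-heavy c a w (_∷_ {x} p ps) = ≤-trans (+-mono-≤ p (∑-heavy c a w ps)) (≤-reflexive (sym (*-distribˡ-+ a (w x) _)))

  many-rich : ∀ D m c R → .{{NonZero D}} → .{{NonZero m}} →
    4 * D * m * c ≤ 2 * D * (4 * D * m * R + c * m) → c ≤ 4 * D * R
  many-rich D m c R double =
    *-cancelˡ-≤ (2 * D * m) {{m*n≢0 (2 * D) m {{m*n≢0 2 D}}}} (+-cancelʳ-≤ (2 * D * m * c) _ _ (begin
      2 * D * m * c + 2 * D * m * c            ≡⟨ lem₁ D m c ⟩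
      4 * D * m * c                            ≤⟨ double ⟩
      2 * D * (4 * D * m * R + c * m)          ≡⟨ lem₂ D m c R ⟩
      2 * D * m * (4 * D * R) + 2 * D * m * c  ∎))
    where
    open ≤-Reasoning
    open +-*-Solver
    lem₁ : ∀ D m c → 2 * D * m * c + 2 * D * m * c ≡ 4 * D * m * c
    lem₁ = solve 3 (λ D m c → con 2 :* D :* m :* c :+ con 2 :* D :* m :* c := con 4 :* D :* m :* c) refl
    lem₂ : ∀ D m c R → 2 * D * (4 * D * m * R + c * m) ≡ 2 * D * m * (4 * D * R) + 2 * D * m * c
    lem₂ = solve 4 (λ D m c R → con 2 :* D :* (con 4 :* D :* m :* R :+ c :* m)
             := con 2 :* D :* m :* (con 4 :* D :* R) :+ con 2 :* D :* m :* c) refl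

  -- The heavy points of `Z` have at least `q * length Y / (2 * D) = 2 * m * length
  -- Y` edges to `Y`. Those at points `y` with fewer than `m` neighbours make up at most half of
  -- them, and each other `y` accounts for at most `q = 4 * D * m`.
  rich-points : ∀ D m → .{{NonZero D}} → .{{NonZero m}} → let q = 4 * D * m in
    ∀ (Z : List A) (Y : List B) (f : A → B → Bool) → length Z ≡ q →
    All (λ x → length Y ≤ 2 * D * ∑ Y (λ y → ⟦ f x y ⟧)) Z →
    length Y ≤ 4 * D * ∑ Y (λ y → ⟦ m ≤ᵇ ∑ Z (λ z → ⟦ f z y ⟧) ⟧)
  rich-points {A} {B} D m Z Y f |Z| hv = many-rich D m (length Y) _ (begin
      q * c                      ≡⟨ cong (_* c) |Z| ⟨
      length Z * c               ≤⟨ ∑-heavy c (2 * D) _ hv ⟩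
      2 * D * ∑ Z (λ z → ∑ Y (λ y → ⟦ f z y ⟧)) ≡⟨ cong (2 * D *_) (∑-swap Z Y _) ⟩
      2 * D * ∑ Y seen           ≤⟨ *-monoʳ-≤ (2 * D) (∑-mono Y (λ y → threshold m q (seen y) (seen≤q y))) ⟩
      2 * D * ∑ Y (λ y → q * ⟦ m ≤ᵇ seen y ⟧ + m) ≡⟨ cong (2 * D *_) (∑-+ Y _ _) ⟩
      2 * D * (∑ Y (λ y → q * ⟦ m ≤ᵇ seen y ⟧) + ∑ Y (λ _ → m))
        ≡⟨ cong (2 * D *_) (cong₂ _+_ (∑-*ˡ Y q _) (∑-const Y m)) ⟩
      2 * D * (q * ∑ Y (λ y → ⟦ m ≤ᵇ seen y ⟧) + c * m) ∎)
    where
    open ≤-Reasoning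
    q = 4 * D * m
    c = length Y
    seen : B → ℕ
    seen y = ∑ Z (λ z → ⟦ f z y ⟧)
    seen≤q : ∀ y → seen y ≤ q
    seen≤q y = ≤-trans (∑-mono Z (λ z → ⟦⟧≤1 (f z y))) (≤-reflexive (trans (∑-length Z) |Z|))

  -- Kővári–Sós–Turán, one vertex class at a time: among q = 4Dm heavy points of X a
  -- typical y sees at least m, and the pigeonhole principle fixes which m.
  common-neighbours : ∀ D m → .{{NonZero D}} → .{{NonZero m}} → let q = 4 * D * m in
    ∀ (X : List A) (Y : List B) (f : A → B → Bool) → 0 < length Y → 2 * D * q < length X →
    length X * length Y ≤ D * ∑ X (λ x → ∑ Y (λ y → ⟦ f x y ⟧)) →
    ∃ λ V → V ⊆ X × length V ≡ m ×
      length Y ≤ 4 * D * 2 ^ q * ∑ Y (λ y → ⟦ all (λ x → f x y) V ⟧)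
  common-neighbours {A} {B} D m X Y f Y>0 big dense =
    let Z , Z⊆X , |Z| , hv = heavy D (length Y) (4 * D * m) X _ Y>0
          (λ x → ≤-trans (∑-mono Y (λ y → ⟦⟧≤1 (f x y))) (≤-reflexive (∑-length Y))) dense big
        manyRich = rich-points D m Z Y f |Z| hv
        V , V∈ , V-good = ∑-pigeonhole (choose m Z) Y (λ y → m ≤ᵇ ∑ Z (λ z → ⟦ f z y ⟧))
          (λ V y → all (λ x → f x y) V)
          (λ y t → choose-complete m Z (λ z → f z y) (≤ᵇ⇒≤ m _ t))
          (positive-factor (4 * D) _ Y>0 manyRich)
        V⊆Z , |V| = choose-sound m Z V∈
    -- The factor `4 * D` comes from `rich-points`, the factor `2 ^ q` bounds the number of sublists
    -- of `Z`.
    in  V , ⊆-trans V⊆Z Z⊆X , |V| , combine (4 * D) _ manyRich V-good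
              (≤-trans (choose-length m Z) (≤-reflexive (cong (2 ^_) |Z|)))
    where
    combine : ∀ {y r l s} a b → y ≤ a * r → r ≤ l * s → l ≤ b → y ≤ a * b * s
    combine {y} {r} {l} {s} a b p q t = begin
      y           ≤⟨ p ⟩
      a * r       ≤⟨ *-monoʳ-≤ a q ⟩
      a * (l * s) ≤⟨ *-monoʳ-≤ a (*-monoˡ-≤ s t) ⟩
      a * (b * s) ≡⟨ *-assoc a b s ⟨
      a * b * s   ∎
      where open ≤-Reasoning

  -- Dense relations on tuples

  tuples : List A → ∀ q → List (Vec A q)
  tuples X zero    = [] ∷ []
  tuples X (suc q) = cartesianProductWith _∷_ X (tuples X q)

  ∑-cartesian : ∀ {C : Set} (_⊗_ : A → B → C) (X : List A) (Y : List B) F →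
    ∑ (cartesianProductWith _⊗_ X Y) F ≡ ∑ X (λ x → ∑ Y (λ y → F (x ⊗ y)))
  ∑-cartesian _⊗_ []      Y F = refl
  ∑-cartesian _⊗_ (x ∷ X) Y F = trans (∑-++ (map (x ⊗_) Y) _ F)
    (cong₂ _+_ (∑-map (x ⊗_) Y F) (∑-cartesian _⊗_ X Y F))

  length-tuples : ∀ (X : List A) q → length (tuples X q) ≡ length X ^ q
  length-tuples X zero    = refl
  length-tuples X (suc q) = trans (sym (∑-length (tuples X (suc q))))
    (trans (∑-cartesian _∷_ X (tuples X q) (λ _ → 1))
    (trans (∑-cong X (λ _ → trans (∑-length (tuples X q)) (length-tuples X q))) (∑-const X _)))

  -- `f` is regarded as a `Q`-partite `Q`-uniform hypergraph with a copy of `X` as each vertex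
  -- class; the sets in `Vs` may therefore overlap.
  CompletePartite : Set → (Q m D N₀ : ℕ) → Set
  CompletePartite A Q m D N₀ = (X : List A) (f : Vec A Q → Bool) → N₀ ≤ length X →
    length X ^ Q ≤ D * ∑ (tuples X Q) (⟦_⟧ ∘ f) →
    ∃ λ (Vs : Vec (List A) Q) → VAll.All (λ V → V ⊆ X × length V ≡ m) Vs ×
      (∀ w → Pointwise _∈_ w Vs → T (f w))

  -- Separating the first coordinate turns `f` into a bipartite graph between `X` and the
  -- `Q`-tuples. `step` gives a set `V` with a dense family of common neighbours, and the induction
  -- hypothesis is applied to this family.
  complete-partite-suc : ∀ {Q} m D N₀ N₁ D′ →
    (∀ (X : List A) (Y : List (Vec A Q)) (f : A → Vec A Q → Bool) → 0 < length Y → N₁ < length X →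
      length X * length Y ≤ D * ∑ X (λ x → ∑ Y (λ y → ⟦ f x y ⟧)) →
      ∃ λ V → V ⊆ X × length V ≡ m × length Y ≤ D′ * ∑ Y (λ y → ⟦ all (λ x → f x y) V ⟧)) →
    CompletePartite A Q m D′ N₀ → CompletePartite A (suc Q) m D (suc N₁ + N₀)
  complete-partite-suc {Q = Q} m D N₀ N₁ D′ step IH X f big dense =
    let V , V⊆X , |V| , dense′ = step X (tuples X Q) (λ x v → f (x ∷ v))
           (subst (0 <_) (sym (length-tuples X Q))
             (m^n>0 (length X) {{>-nonZero (≤-trans (s≤s z≤n) big)}} Q))
           (≤-trans (m≤m+n _ N₀) big)
           (subst₂ (λ a b → length X * a ≤ D * b) (sym (length-tuples X Q))
             (∑-cartesian _∷_ X (tuples X Q) (⟦_⟧ ∘ f)) dense)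
        Vs , sub , full = IH X (λ v → all (λ x → f (x ∷ v)) V) (≤-trans (m≤n+m N₀ _) big)
           (subst (_≤ D′ * ∑ (tuples X Q) (λ v → ⟦ all (λ x → f (x ∷ v)) V ⟧)) (length-tuples X Q) dense′)
    in V ∷ Vs , (V⊆X , |V|) ∷ sub ,
       λ { (x ∷ v) (i ∷ is) → all⇒T (λ x → f (x ∷ v)) (full v is) i }

  -- Erdős' theorem on complete multipartite subhypergraphs of dense hypergraphs.
  complete-partite : ∀ Q m D → .{{NonZero m}} → .{{NonZero D}} → Σ ℕ (CompletePartite A Q m D)
  complete-partite zero m D = 0 , λ X f _ dense →
    [] , [] , λ { [] [] → ⟦⟧⇒T (subst (0 <_) (+-identityʳ _) (positive-factor D _ (s≤s z≤n) dense)) }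
  complete-partite (suc Q) m D =
    let N₀ , IH = complete-partite Q m (4 * D * 2 ^ (4 * D * m))
                    {{it}} {{m*n≢0 (4 * D) _ {{m*n≢0 4 D}} {{m^n≢0 2 (4 * D * m)}}}}
    in  _ , complete-partite-suc m D N₀ _ (4 * D * 2 ^ (4 * D * m)) (common-neighbours D m) IH

  -- Makes a relation between two tuples a relation on one longer tuple, the form in which
  -- `complete-partite` takes it.
  uncurryᵛ : ∀ p {q} → (Vec A p → Vec A q → C) → Vec A (p + q) → C
  uncurryᵛ zero    F w       = F [] w
  uncurryᵛ (suc p) F (x ∷ w) = uncurryᵛ p (λ u → F (x ∷ u)) w

  uncurryᵛ-++ : ∀ {p q} (F : Vec A p → Vec A q → C) u v → uncurryᵛ p F (u ++ᵛ v) ≡ F u v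
  uncurryᵛ-++ F []      v = refl
  uncurryᵛ-++ F (x ∷ u) v = uncurryᵛ-++ (λ u → F (x ∷ u)) u v

  ∑-uncurryᵛ : ∀ (X : List A) p q (F : Vec A p → Vec A q → C) (g : C → ℕ) →
    ∑ (tuples X (p + q)) (g ∘ uncurryᵛ p F) ≡ ∑ (tuples X p) (λ u → ∑ (tuples X q) (λ v → g (F u v)))
  ∑-uncurryᵛ X zero    q F g = sym (+-identityʳ _)
  ∑-uncurryᵛ X (suc p) q F g =
    trans (∑-cartesian _∷_ X (tuples X (p + q)) (g ∘ uncurryᵛ (suc p) F))
    (trans (∑-cong X (λ x → ∑-uncurryᵛ X p q (λ u → F (x ∷ u)) g))
           (sym (∑-cartesian _∷_ X (tuples X p) _)))

  -- Random pairs of tuples and their adjacency patterns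

  anyᵛ : ∀ {q} → (A → Bool) → Vec A q → Bool
  anyᵛ g []      = false
  anyᵛ g (x ∷ v) = g x ∨ anyᵛ g v

  -- The coordinates of a random tuple are independent, so the count is a product.
  ∑-avoid : ∀ (X : List A) q (g : A → Bool) →
    ∑ (tuples X q) (λ v → ⟦ not (anyᵛ g v) ⟧) ≡ ∑ X (λ x → ⟦ not (g x) ⟧) ^ q
  ∑-avoid X zero    g = refl
  ∑-avoid X (suc q) g =
    trans (∑-cartesian _∷_ X (tuples X q) _)
    (trans (∑-cong X (λ x → trans (∑-cong (tuples X q) (λ v → not-∨ (g x) (anyᵛ g v))) (∑-*ˡ (tuples X q) ⟦ not (g x) ⟧ (λ v → ⟦ not (anyᵛ g v) ⟧))))
    (trans (∑-*ʳ X _ (λ x → ⟦ not (g x) ⟧)) (cong (∑ X (λ x → ⟦ not (g x) ⟧) *_) (∑-avoid X q g))))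
    where
    not-∨ : ∀ a b → ⟦ not (a ∨ b) ⟧ ≡ ⟦ not a ⟧ * ⟦ not b ⟧
    not-∨ true  b = refl
    not-∨ false b = sym (+-identityʳ _)

  ∑-complement : ∀ E (X : List A) (g : A → Bool) → length X ≤ suc E * ∑ X (⟦_⟧ ∘ g) →
    suc E * ∑ X (λ x → ⟦ not (g x) ⟧) ≤ E * length X
  ∑-complement E X g dense = +-cancelˡ-≤ (suc E * y) _ _ (begin
    suc E * y + suc E * z ≡⟨ *-distribˡ-+ (suc E) y z ⟨
    suc E * (y + z)       ≡⟨ cong (suc E *_) total ⟩
    length X + E * length X ≤⟨ +-monoˡ-≤ (E * length X) dense ⟩
    suc E * y + E * length X ∎)
    where
    open ≤-Reasoning
    y = ∑ X (⟦_⟧ ∘ g)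
    z = ∑ X (λ x → ⟦ not (g x) ⟧)
    one : ∀ b → ⟦ b ⟧ + ⟦ not b ⟧ ≡ 1
    one true  = refl
    one false = refl
    total : y + z ≡ length X
    total = trans (sym (∑-+ X _ _)) (trans (∑-cong X (one ∘ g)) (∑-length X))

  ^-distribʳ-* : ∀ o m n → (m * n) ^ o ≡ m ^ o * n ^ o
  ^-distribʳ-* zero    m n = refl
  ^-distribʳ-* (suc o) m n = trans (cong (m * n *_) (^-distribʳ-* o m n)) (lem m n (m ^ o) (n ^ o))
    where
    lem : ∀ a b c d → a * b * (c * d) ≡ a * c * (b * d)
    lem = solve 4 (λ a b c d → a :* b :* (c :* d) := a :* c :* (b :* d)) refl where open +-*-Solver

  module _ (R : A → A → Bool) where

    failures : ∀ {p q} → Vec A p → Vec A q → ℕ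
    failures u v = ∑ (toList u) (λ x → ⟦ not (anyᵛ (R x) v) ⟧)

    -- Not a matching in the strict sense: several entries of the first tuple may use the same entry
    -- of the second.
    matchable : ∀ {p q} → Vec A p → Vec A q → Bool
    matchable []      v = true
    matchable (x ∷ u) v = anyᵛ (R x) v ∧ matchable u v

    -- The pattern `r` fixes which neighbour is used; for fixed `r` the condition is a conjunction
    -- of single edges and so can be read off from a complete blow-up.
    follows : ∀ {p q} → Vec A p → Vec A q → Vec (Fin q) p → Bool
    follows []      v []      = true
    follows (x ∷ u) v (i ∷ r) = R x (lookup v i) ∧ follows u v r

    follows⇒ : ∀ {p q} (u : Vec A p) (v : Vec A q) r → T (follows u v r) →
               ∀ i → T (R (lookup u i) (lookup v (lookup r i)))
    follows⇒ (x ∷ u) v (j ∷ r) t zero    = proj₁ (Equivalence.to (T-∧ {R x (lookup v j)}) t)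
    follows⇒ (x ∷ u) v (j ∷ r) t (suc i) = follows⇒ u v r (proj₂ (Equivalence.to (T-∧ {R x (lookup v j)}) t)) i

    matchable⇒follows : ∀ {p q} (u : Vec A p) (v : Vec A q) → T (matchable u v) → ∃ λ r → T (follows u v r)
    matchable⇒follows []      v t = [] , tt
    matchable⇒follows (x ∷ u) v t =
      let tx , tu = Equivalence.to (T-∧ {anyᵛ (R x) v}) t
          i , ti  = witness v tx
          r , tr  = matchable⇒follows u v tu
      in  i ∷ r , Equivalence.from T-∧ (ti , tr)
      where
      witness : ∀ {q} (v : Vec A q) → T (anyᵛ (R x) v) → ∃ λ i → T (R x (lookup v i))
      witness (y ∷ v) t with Equivalence.to (T-∨ {R x y}) t
      ... | inj₁ t = zero , t
      ... | inj₂ t = let i , s = witness v t in suc i , s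

    match-or-fail : ∀ {p q} (u : Vec A p) (v : Vec A q) → 1 ≤ ⟦ matchable u v ⟧ + failures u v
    match-or-fail []      v = ≤-refl
    match-or-fail (x ∷ u) v with anyᵛ (R x) v
    ... | true  = match-or-fail u v
    ... | false = s≤s z≤n

    -- First moment bound. A random `v` contains no neighbour of a fixed `x` with probability at
    -- most `(E / (E + 1)) ^ Q`; summed over the `Q` entries of `u` this is at most `1 / 4` by the
    -- assumption on `Q`.
    few-failures : ∀ E Q (X : List A) → .{{_ : NonZero Q}} → .{{_ : NonZero E}} →
      4 * (Q * E ^ Q) ≤ suc E ^ Q → (∀ x → length X ≤ suc E * ∑ X (⟦_⟧ ∘ R x)) →
      4 * ∑ (tuples X Q) (λ u → ∑ (tuples X Q) (λ v → failures u v)) ≤ length X ^ Q * length X ^ Q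
    few-failures E Q X large dense = *-cancelˡ-≤ K {{m*n≢0 Q (E ^ Q) {{it}} {{m^n≢0 E Q}}}} (begin
      K * (4 * tot)                       ≡⟨ lem K tot ⟩
      4 * K * tot                         ≤⟨ *-monoˡ-≤ tot large ⟩
      suc E ^ Q * tot                     ≡⟨ ∑-*ˡ (tuples X Q) (suc E ^ Q) _ ⟨
      ∑ (tuples X Q) (λ u → suc E ^ Q * ∑ (tuples X Q) (λ v → failures u v)) ≤⟨ ∑-mono (tuples X Q) fixed ⟩
      ∑ (tuples X Q) (λ _ → Q * (E * N) ^ Q) ≡⟨ ∑-const (tuples X Q) _ ⟩
      length (tuples X Q) * (Q * (E * N) ^ Q) ≡⟨ cong₂ (λ a b → a * (Q * b)) (length-tuples X Q) (^-distribʳ-* Q E N) ⟩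
      N ^ Q * (Q * (E ^ Q * N ^ Q))       ≡⟨ lem₂ (N ^ Q) Q (E ^ Q) ⟩
      K * (N ^ Q * N ^ Q)                 ∎)
      where
      open ≤-Reasoning
      N = length X
      K = Q * E ^ Q
      tot = ∑ (tuples X Q) (λ u → ∑ (tuples X Q) (λ v → failures u v))
      lem : ∀ k t → k * (4 * t) ≡ 4 * k * t
      lem = solve 2 (λ k t → k :* (con 4 :* t) := con 4 :* k :* t) refl where open +-*-Solver
      lem₂ : ∀ n q e → n * (q * (e * n)) ≡ q * e * (n * n)
      lem₂ = solve 3 (λ n q e → n :* (q :* (e :* n)) := q :* e :* (n :* n)) refl where open +-*-Solver
      single : ∀ x → suc E ^ Q * ∑ (tuples X Q) (λ v → ⟦ not (anyᵛ (R x) v) ⟧) ≤ (E * N) ^ Q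
      single x = begin
        suc E ^ Q * ∑ (tuples X Q) (λ v → ⟦ not (anyᵛ (R x) v) ⟧) ≡⟨ cong (suc E ^ Q *_) (∑-avoid X Q (R x)) ⟩
        suc E ^ Q * ∑ X (λ y → ⟦ not (R x y) ⟧) ^ Q  ≡⟨ ^-distribʳ-* Q (suc E) _ ⟨
        (suc E * ∑ X (λ y → ⟦ not (R x y) ⟧)) ^ Q    ≤⟨ ^-monoˡ-≤ Q (∑-complement E X (R x) (dense x)) ⟩
        (E * N) ^ Q ∎
      fixed : ∀ u → suc E ^ Q * ∑ (tuples X Q) (λ v → failures u v) ≤ Q * (E * N) ^ Q
      fixed u = begin
        suc E ^ Q * ∑ (tuples X Q) (λ v → failures u v) ≡⟨ cong (suc E ^ Q *_) (∑-swap (tuples X Q) (toList u) _) ⟩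
        suc E ^ Q * ∑ (toList u) (λ x → ∑ (tuples X Q) (λ v → ⟦ not (anyᵛ (R x) v) ⟧)) ≡⟨ ∑-*ˡ (toList u) (suc E ^ Q) _ ⟨
        ∑ (toList u) (λ x → suc E ^ Q * ∑ (tuples X Q) (λ v → ⟦ not (anyᵛ (R x) v) ⟧)) ≤⟨ ∑-mono (toList u) single ⟩
        ∑ (toList u) (λ _ → (E * N) ^ Q)  ≡⟨ ∑-const (toList u) _ ⟩
        length (toList u) * (E * N) ^ Q   ≡⟨ cong (_* (E * N) ^ Q) (length-toList u) ⟩
        Q * (E * N) ^ Q ∎

  -- Bernoulli's inequality `(1 + 1 / E) ^ k ≥ 1 + k / E`, multiplied by `E ^ (k + 1)`.
  bernoulli : ∀ E k → (E + k) * E ^ k ≤ E * suc E ^ k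
  bernoulli E zero    = ≤-reflexive (cong (_* 1) (+-identityʳ E))
  bernoulli E (suc k) = begin
    (E + suc k) * (E * E ^ k)             ≤⟨ m≤m+n _ (k * E ^ k) ⟩
    (E + suc k) * (E * E ^ k) + k * E ^ k ≡⟨ lem₁ E k (E ^ k) ⟩
    (E + k) * E ^ k * suc E               ≤⟨ *-monoˡ-≤ (suc E) (bernoulli E k) ⟩
    E * suc E ^ k * suc E                 ≡⟨ lem₂ E (suc E ^ k) ⟩
    E * (suc E * suc E ^ k)               ∎
    where
    open ≤-Reasoning
    open +-*-Solver
    lem₁ : ∀ E k p → (E + suc k) * (E * p) + k * p ≡ (E + k) * p * suc E
    lem₁ = solve 3 (λ E k p → (E :+ (con 1 :+ k)) :* (E :* p) :+ k :* p := (E :+ k) :* p :* (con 1 :+ E)) refl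
    lem₂ : ∀ E p → E * p * suc E ≡ E * (suc E * p)
    lem₂ = solve 2 (λ E p → E :* p :* (con 1 :+ E) := E :* ((con 1 :+ E) :* p)) refl

  n<2^n : ∀ n → n < 2 ^ n
  n<2^n zero    = s≤s z≤n
  n<2^n (suc n) = ≤-trans (+-mono-≤ (m^n>0 2 n) (n<2^n n)) (+-monoʳ-≤ (2 ^ n) (m≤m+n _ 0))

  -- By Bernoulli `(1 + 1 / E) ^ E ≥ 2`. With `s = 16 * E` and `Q = E * s` this gives `(1 + 1 / E) ^
  -- Q ≥ 2 ^ s = (2 ^ (8 * E)) ^ 2 ≥ (8 * E) ^ 2 = 4 * Q`.
  sample-size : ∀ E → .{{NonZero E}} → ∃ λ Q → NonZero Q × 4 * (Q * E ^ Q) ≤ suc E ^ Q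
  sample-size E = Q , m*n≢0 E s {{it}} {{m*n≢0 16 E}} , (begin
    4 * (E * s * E ^ (E * s))     ≡⟨ *-assoc 4 (E * s) _ ⟨
    4 * (E * s) * E ^ (E * s)     ≤⟨ *-monoˡ-≤ (E ^ (E * s)) 4Es≤2^s ⟩
    2 ^ s * E ^ (E * s)           ≡⟨ cong (2 ^ s *_) (^-*-assoc E E s) ⟨
    2 ^ s * (E ^ E) ^ s           ≡⟨ ^-distribʳ-* s 2 (E ^ E) ⟨
    (2 * E ^ E) ^ s               ≤⟨ ^-monoˡ-≤ s doubling ⟩
    (suc E ^ E) ^ s               ≡⟨ ^-*-assoc (suc E) E s ⟩
    suc E ^ (E * s)               ∎)
    where
    open ≤-Reasoning
    a = 8 * E
    s = 16 * E
    Q = E * s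
    doubling : 2 * E ^ E ≤ suc E ^ E
    doubling = *-cancelˡ-≤ E (≤-trans (≤-reflexive (lem E (E ^ E))) (bernoulli E E))
      where
      lem : ∀ E p → E * (2 * p) ≡ (E + E) * p
      lem = solve 2 (λ E p → E :* (con 2 :* p) := (E :+ E) :* p) refl where open +-*-Solver
    4Es≤2^s : 4 * (E * s) ≤ 2 ^ s
    4Es≤2^s = begin
      4 * (E * (16 * E))   ≡⟨ lem₁ E ⟩
      a * a                ≤⟨ *-mono-≤ (<⇒≤ (n<2^n a)) (<⇒≤ (n<2^n a)) ⟩
      2 ^ a * 2 ^ a        ≡⟨ ^-distribˡ-+-* 2 a a ⟨
      2 ^ (a + a)          ≡⟨ cong (2 ^_) (lem₂ E) ⟩
      2 ^ s                ∎
      where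
      open +-*-Solver
      lem₁ : ∀ E → 4 * (E * (16 * E)) ≡ 8 * E * (8 * E)
      lem₁ = solve 1 (λ E → con 4 :* (E :* (con 16 :* E)) := con 8 :* E :* (con 8 :* E)) refl
      lem₂ : ∀ E → 8 * E + 8 * E ≡ 16 * E
      lem₂ = solve 1 (λ E → con 8 :* E :+ con 8 :* E := con 16 :* E) refl

  -- Blowing a pattern up to clusters

  tuples-complete : ∀ {X : List A} → (∀ x → x ∈ X) → ∀ {q} (v : Vec A q) → v ∈ tuples X q
  tuples-complete ∈X []      = here refl
  tuples-complete ∈X (x ∷ v) = ∈-cartesianProductWith⁺ _∷_ (∈X x) (tuples-complete ∈X v)

  transversal : ∀ {m q} {P : List A → Set} (Us : Vec (List A) q) → VAll.All (λ U → P U × length U ≡ suc m) Us →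
    ∃ λ (u : Vec A q) → Pointwise _∈_ u Us
  transversal []             []               = [] , []
  transversal ((x ∷ U) ∷ Us) (_ ∷ ps) = let u , i = transversal Us ps in x ∷ u , here refl ∷ i

  -- Completeness of a blow-up speaks of full tuples. To obtain a single edge between two clusters,
  -- the remaining coordinates are filled with arbitrary elements of the nonempty clusters.
  transversal-through : ∀ {m q} {P : List A → Set} (Us : Vec (List A) q) →
    VAll.All (λ U → P U × length U ≡ suc m) Us → ∀ i {x} → x ∈ lookup Us i →
    ∃ λ (u : Vec A q) → Pointwise _∈_ u Us × lookup u i ≡ x
  transversal-through (U ∷ Us) (_ ∷ ps) zero {x} x∈ =
    let u , is = transversal Us ps in x ∷ u , x∈ ∷ is , refl
  transversal-through ((y ∷ U) ∷ Us) (_ ∷ ps) (suc i) x∈ =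
    let u , is , e = transversal-through Us ps i x∈ in y ∷ u , here refl ∷ is , e

  -- `r` and `b` are functions on indices, so an alternating red and blue walk through the clusters
  -- can be continued from every cluster. Clusters may overlap.
  record Blowup (X : List A) (R B : A → A → Bool) (Q m : ℕ) : Set where
    field
      Us Vs  : Vec (List A) Q
      Us-sub : VAll.All (λ U → U ⊆ X × length U ≡ m) Us
      Vs-sub : VAll.All (λ V → V ⊆ X × length V ≡ m) Vs
      r b    : Fin Q → Fin Q
      red    : ∀ i {p q} → p ∈ lookup Us i → q ∈ lookup Vs (r i) → T (R p q)
      blue   : ∀ j {p q} → p ∈ lookup Vs j → q ∈ lookup Us (b j) → T (B p q)

  half : ∀ n g f₁ f₂ → n ≤ g + (f₁ + f₂) → 4 * f₁ ≤ n → 4 * f₂ ≤ n → n ≤ 2 * g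
  half n g f₁ f₂ le le₁ le₂ = *-cancelˡ-≤ 2 (+-cancelʳ-≤ (n + n) _ _ (begin
    2 * n + (n + n)            ≡⟨ lem₁ n ⟩
    4 * n                      ≤⟨ *-monoʳ-≤ 4 le ⟩
    4 * (g + (f₁ + f₂))        ≡⟨ lem₂ g f₁ f₂ ⟩
    2 * (2 * g) + (4 * f₁ + 4 * f₂) ≤⟨ +-monoʳ-≤ (2 * (2 * g)) (+-mono-≤ le₁ le₂) ⟩
    2 * (2 * g) + (n + n)      ∎))
    where
    open ≤-Reasoning
    open +-*-Solver
    lem₁ : ∀ n → 2 * n + (n + n) ≡ 4 * n
    lem₁ = solve 1 (λ n → con 2 :* n :+ (n :+ n) := con 4 :* n) refl
    lem₂ : ∀ g a b → 4 * (g + (a + b)) ≡ 2 * (2 * g) + (4 * a + 4 * b)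
    lem₂ = solve 3 (λ g a b → con 4 :* (g :+ (a :+ b)) := con 2 :* (con 2 :* g) :+ (con 4 :* a :+ con 4 :* b)) refl

  module _ (R B : A → A → Bool) (Q : ℕ) where

    good : Vec A Q → Vec A Q → Bool
    good u v = matchable R u v ∧ matchable B v u

    patterns : List (Vec (Fin Q) Q × Vec (Fin Q) Q)
    patterns = cartesianProduct (tuples (allFin Q) Q) (tuples (allFin Q) Q)

    fits : Vec (Fin Q) Q × Vec (Fin Q) Q → Vec A Q → Vec A Q → Bool
    fits (r , b) u v = follows R u v r ∧ follows B v u b

    good⇒fits : ∀ u v → T (good u v) → ∃ λ rb → rb ∈ patterns × T (fits rb u v)
    good⇒fits u v t =
      let tr , tb = Equivalence.to (T-∧ {matchable R u v}) t
          r , fr  = matchable⇒follows R u v tr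
          b , fb  = matchable⇒follows B v u tb
      in (r , b) , ∈-cartesianProduct⁺ (tuples-complete ∈-allFin r) (tuples-complete ∈-allFin b) ,
         Equivalence.from T-∧ (fr , fb)

    -- Union bound: a pair that is not good has a red or a blue failure, and each kind of failure
    -- has mean at most `1 / 4`.
    many-good : ∀ E (X : List A) → .{{_ : NonZero Q}} → .{{_ : NonZero E}} → 4 * (Q * E ^ Q) ≤ suc E ^ Q →
      (∀ x → length X ≤ suc E * ∑ X (⟦_⟧ ∘ R x)) → (∀ x → length X ≤ suc E * ∑ X (⟦_⟧ ∘ B x)) →
      length X ^ Q * length X ^ Q ≤ 2 * ∑ (tuples X Q) (λ u → ∑ (tuples X Q) (λ v → ⟦ good u v ⟧))
    many-good E X large dR dB = half (length X ^ Q * length X ^ Q)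
      (∑ Y (λ u → ∑ Y (λ v → ⟦ good u v ⟧))) (∑ Y (λ u → ∑ Y (λ v → FR u v))) (∑ Y (λ u → ∑ Y (λ v → FB u v))) count
      (few-failures R E Q X large dR) (few-failures B E Q X large dB)
      where
      open ≤-Reasoning
      Y = tuples X Q
      FR = λ u v → failures R {Q} {Q} u v
      FB = λ u v → failures B {Q} {Q} u v
      and-bound : ∀ a b {x y} → 1 ≤ ⟦ a ⟧ + x → 1 ≤ ⟦ b ⟧ + y → 1 ≤ ⟦ a ∧ b ⟧ + (x + y)
      and-bound true  b _ le = ≤-trans le (+-monoʳ-≤ ⟦ b ⟧ (m≤n+m _ _))
      and-bound false b le _ = ≤-trans le (m≤m+n _ _)
      one : ∀ u v → 1 ≤ ⟦ good u v ⟧ + (FR u v + FB v u)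
      one u v = and-bound (matchable R u v) (matchable B v u) (match-or-fail R u v) (match-or-fail B v u)
      count : length X ^ Q * length X ^ Q ≤
        ∑ Y (λ u → ∑ Y (λ v → ⟦ good u v ⟧)) + (∑ Y (λ u → ∑ Y (λ v → FR u v)) + ∑ Y (λ u → ∑ Y (λ v → FB u v)))
      count = begin
        length X ^ Q * length X ^ Q     ≡⟨ cong₂ _*_ (length-tuples X Q) (length-tuples X Q) ⟨
        length Y * length Y             ≡⟨ ∑-const Y _ ⟨
        ∑ Y (λ _ → length Y)            ≡⟨ ∑-cong Y (λ _ → ∑-length Y) ⟨
        ∑ Y (λ _ → ∑ Y (λ _ → 1))       ≤⟨ ∑-mono Y (λ u → ∑-mono Y (λ v → one u v)) ⟩
        ∑ Y (λ u → ∑ Y (λ v → ⟦ good u v ⟧ + (FR u v + FB v u)))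
          ≡⟨ ∑-cong Y (λ u → trans (∑-+ Y _ _) (cong (∑ Y (λ v → ⟦ good u v ⟧) +_) (∑-+ Y _ _))) ⟩
        ∑ Y (λ u → ∑ Y (λ v → ⟦ good u v ⟧) + (∑ Y (λ v → FR u v) + ∑ Y (λ v → FB v u)))
          ≡⟨ trans (∑-+ Y _ _) (cong (∑ Y (λ u → ∑ Y (λ v → ⟦ good u v ⟧)) +_) (∑-+ Y _ _)) ⟩
        ∑ Y (λ u → ∑ Y (λ v → ⟦ good u v ⟧)) + (∑ Y (λ u → ∑ Y (λ v → FR u v)) + ∑ Y (λ u → ∑ Y (λ v → FB v u)))
          -- Blue failures are those of `v` against `u`; the sums are exchanged to match the order
          -- in `few-failures`.
          ≡⟨ cong (λ z → ∑ Y (λ u → ∑ Y (λ v → ⟦ good u v ⟧)) + (∑ Y (λ u → ∑ Y (λ v → FR u v)) + z)) (∑-swap Y Y _) ⟩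
        ∑ Y (λ u → ∑ Y (λ v → ⟦ good u v ⟧)) + (∑ Y (λ u → ∑ Y (λ v → FR u v)) + ∑ Y (λ v → ∑ Y (λ u → FB v u))) ∎

    complete⇒Blowup : ∀ {X m} rb (Ws : Vec (List A) (Q + Q)) →
      VAll.All (λ V → V ⊆ X × length V ≡ suc m) Ws →
      (∀ w → Pointwise _∈_ w Ws → T (uncurryᵛ Q (fits rb) w)) → Blowup X R B Q (suc m)
    complete⇒Blowup (r , b) Ws sub full with splitAt Q Ws
    ... | Us , Vs , refl = record
      { Us = Us ; Vs = Vs ; Us-sub = subU ; Vs-sub = subV ; r = lookup r ; b = lookup b
      ; red = λ i p∈ q∈ →
          let u , u∈ , u≡ = transversal-through Us subU i p∈
              v , v∈ , v≡ = transversal-through Vs subV (lookup r i) q∈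
          in subst₂ (λ p q → T (R p q)) u≡ v≡
               (follows⇒ R u v r (proj₁ (Equivalence.to (T-∧ {follows R u v r}) (both u∈ v∈))) i)
      ; blue = λ j p∈ q∈ →
          let v , v∈ , v≡ = transversal-through Vs subV j p∈
              u , u∈ , u≡ = transversal-through Us subU (lookup b j) q∈
          in subst₂ (λ p q → T (B p q)) v≡ u≡
               (follows⇒ B v u b (proj₂ (Equivalence.to (T-∧ {follows R u v r}) (both u∈ v∈))) j)
      }
      where
      subs = VAllP.++⁻ Us sub
      subU = proj₁ subs
      subV = proj₂ subs
      both : ∀ {u v} → Pointwise _∈_ u Us → Pointwise _∈_ v Vs → T (fits (r , b) u v)
      both {u} {v} u∈ v∈ = subst T (uncurryᵛ-++ (fits (r , b)) u v) (full (u ++ᵛ v) (PW.++⁺ u∈ v∈))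

    -- At least half of all pairs of tuples are good and each good pair fits one of the finitely
    -- many patterns. Hence one pattern is fitted by a fraction of at least `1 / D` of the pairs,
    -- which is the density that `complete` asks for.
    find-blowup : ∀ E D N₀ m (X : List A) → .{{_ : NonZero Q}} → .{{_ : NonZero E}} →
      4 * (Q * E ^ Q) ≤ suc E ^ Q → 2 * length patterns ≤ D → CompletePartite A (Q + Q) (suc m) D N₀ →
      suc N₀ ≤ length X →
      (∀ x → length X ≤ suc E * ∑ X (⟦_⟧ ∘ R x)) → (∀ x → length X ≤ suc E * ∑ X (⟦_⟧ ∘ B x)) →
      Blowup X R B Q (suc m)
    find-blowup E D N₀ m X large D-large complete big dR dB =
      let rb , _ , le = ∑-pigeonhole patterns (tuples X (Q + Q)) (uncurryᵛ Q good)
                          (λ rb → uncurryᵛ Q (fits rb)) cover pos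
          Ws , sub , full = complete X (uncurryᵛ Q (fits rb)) (≤-trans (n≤1+n _) big) (dense _ le)
      in complete⇒Blowup rb Ws sub full
      where
      G = ∑ (tuples X (Q + Q)) (⟦_⟧ ∘ uncurryᵛ Q good)
      cover : ∀ w → T (uncurryᵛ Q good w) → ∃ λ rb → rb ∈ patterns × T (uncurryᵛ Q (fits rb) w)
      cover w t with splitAt Q w
      ... | u , v , refl =
        let rb , i , f = good⇒fits u v (subst T (uncurryᵛ-++ good u v) t)
        in rb , i , subst T (sym (uncurryᵛ-++ (fits rb) u v)) f
      many : length X ^ (Q + Q) ≤ 2 * G
      many = subst₂ _≤_ (sym (^-distribˡ-+-* (length X) Q Q))
               (cong (2 *_) (sym (∑-uncurryᵛ X Q Q good ⟦_⟧))) (many-good E X large dR dB)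
      pos : 0 < G
      pos = positive-factor 2 G (m^n>0 (length X) {{>-nonZero (≤-trans (s≤s z≤n) big)}} (Q + Q)) many
      dense : ∀ S → G ≤ length patterns * S → length X ^ (Q + Q) ≤ D * S
      dense S le = ≤-trans many (≤-trans (*-monoʳ-≤ 2 le)
        (≤-trans (≤-reflexive (sym (*-assoc 2 (length patterns) S))) (*-monoˡ-≤ S D-large)))

  -- `Q` depends on the density alone and is fixed before `m`, because the cluster size needed later
  -- is a multiple of `Q`.
  blowup : ∀ E → .{{NonZero E}} → Σ ℕ λ Q → NonZero Q × (∀ m → Σ ℕ λ N₀ →
    ∀ (X : List A) (R B : A → A → Bool) → N₀ ≤ length X →
    (∀ x → length X ≤ suc E * ∑ X (⟦_⟧ ∘ R x)) → (∀ x → length X ≤ suc E * ∑ X (⟦_⟧ ∘ B x)) →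
    Blowup X R B Q (suc m))
  blowup {A} E = from-sample (sample-size E)
    where
    from-sample : (∃ λ Q → NonZero Q × 4 * (Q * E ^ Q) ≤ suc E ^ Q) → _
    from-sample (Q , Q≢0 , large) = Q , Q≢0 , λ m →
      let D = suc (2 * length (cartesianProduct (tuples (allFin Q) Q) (tuples (allFin Q) Q)))
          N₀ , complete = complete-partite {A} (Q + Q) (suc m) D
      in suc N₀ , λ X R B → find-blowup R B Q E D N₀ m X {{Q≢0}} large (n≤1+n _) complete

-- Gluing paths along completely joined classes

module Surgery where
  open import Data.Nat using (_+_; _*_; _∸_; _≤_; _<_)
  open import Data.Nat.Properties

  module Paths {n : ℕ} (G : Graph n) where

    data Path : Fin n → Fin n → List (Fin n) → Set where
      [-] : ∀ {x} → Path x x (x ∷ [])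
      _∷_ : ∀ {x y z xs} → Adj G x y → Path y z xs → Path x z (x ∷ xs)

    Adj-sym : ∀ {x y} → Adj G x y → Adj G y x
    Adj-sym {x} {y} = subst T (Graph.sym G x y)

    path-++ : ∀ {x y z w xs ys} → Path x y xs → Adj G y z → Path z w ys → Path x w (xs ++ ys)
    path-++ [-]     a q = a ∷ q
    path-++ (b ∷ p) a q = b ∷ path-++ p a q

    path-reverse : ∀ {x y xs} → Path x y xs → Path y x (reverse xs)
    path-reverse [-] = [-]
    path-reverse {x} {y} (_∷_ {xs = xs} a p) = subst (Path y x) (sym (unfold-reverse x xs))
      (path-++ (path-reverse p) (Adj-sym a) [-])

    path-nonempty : ∀ {x y xs} → Path x y xs → 1 ≤ length xs
    path-nonempty [-]     = s≤s z≤n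
    path-nonempty (_ ∷ _) = s≤s z≤n

    path⇒ConsecAdj : ∀ {x y xs} → Path x y xs → ConsecAdj G xs
    path⇒ConsecAdj [-]             = tt
    path⇒ConsecAdj (a ∷ [-])       = a , tt
    path⇒ConsecAdj (a ∷ p@(_ ∷ _)) = a , path⇒ConsecAdj p

    closed-path⇒IsCycle : ∀ {x y xs} → Path x y xs → Adj G y x → 3 ≤ length xs → Unique xs → IsCycle G xs
    closed-path⇒IsCycle p@[-]     a len u = ≤-pred len , u , path⇒ConsecAdj (path-++ p a [-])
    closed-path⇒IsCycle p@(_ ∷ _) a len u = ≤-pred len , u , path⇒ConsecAdj (path-++ p a [-])

  module Chains {n : ℕ} (G : Graph n) (Label : Set) (c : Label → Label)
    (Has : Label → Fin n → Set) (c-adj : ∀ {l u v} → Has l u → Has (c l) v → Adj G u v) where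

    open Paths G public

    -- Only the labels of the two end vertices matter for gluing, since any two vertices with
    -- complementary labels are adjacent.
    record Seg (s e : Label) (xs : List (Fin n)) : Set where
      constructor seg
      field
        {first last} : Fin n
        first-has    : Has s first
        last-has     : Has e last
        path         : Path first last xs

    seg-++ : ∀ {s e f xs ys} → Seg s e xs → Seg (c e) f ys → Seg s f (xs ++ ys)
    seg-++ (seg hx hy p) (seg hz hw q) = seg hx hw (path-++ p (c-adj hy hz) q)

    seg-reverse : ∀ {s e xs} → Seg s e xs → Seg e s (reverse xs)
    seg-reverse (seg hx hy p) = seg hy hx (path-reverse p)

    seg-nonempty : ∀ {s e xs} → Seg s e xs → 1 ≤ length xs
    seg-nonempty (seg _ _ p) = path-nonempty p

    -- Chain a b js xs: segments glued at the junctions js; the first one starts with a label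
    -- complementary to a and the last one ends with b, so that a chain from a to a closes up.
    data Chain (a : Label) : Label → List Label → List (Fin n) → Set where
      []  : Chain a a [] []
      _∷_ : ∀ {b e js xs ys} → Seg (c a) e xs → Chain e b js ys → Chain a b (e ∷ js) (xs ++ ys)

    chain-length : ∀ {a b js xs} → Chain a b js xs → length js ≤ length xs
    chain-length [] = z≤n
    chain-length (_∷_ {xs = xs} s ch) =
      ≤-trans (+-mono-≤ (seg-nonempty s) (chain-length ch)) (≤-reflexive (sym (length-++ xs)))

    chain⇒seg : ∀ {a b e js xs} → Chain a b (e ∷ js) xs → Seg (c a) b xs
    chain⇒seg (s ∷ []) = seg-++-[] s
      where
      seg-++-[] : ∀ {s e xs} → Seg s e xs → Seg s e (xs ++ [])
      seg-++-[] {s} {e} {xs} = subst (Seg s e) (sym (++-identityʳ xs))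
    chain⇒seg (s ∷ ch@(_ ∷ _)) = seg-++ s (chain⇒seg ch)

    closed-chain⇒IsCycle : ∀ {a js xs} → Chain a a js xs → 3 ≤ length xs → Unique xs → IsCycle G xs
    closed-chain⇒IsCycle ch@(_ ∷ _) len u =
      let seg hx hy p = chain⇒seg ch in closed-path⇒IsCycle p (c-adj hy hx) len u

    -- The new segment attaches with its start `c e` to the junction `e` and offers `e` again to
    -- whatever followed. No junction is lost, so later insertions remain possible.
    insert : ∀ {a b e js xs ys} → Chain a b js ys → e ∈ js → Seg (c e) e xs →
      ∃ λ js′ → ∃ λ zs → Chain a b js′ zs × (∀ {l} → l ∈ js → l ∈ js′) × zs ↭ xs ++ ys
    insert {xs = xs} (_∷_ {xs = ys₁} {ys = ys₂} s ch) (here refl) t =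
      _ , _ , s ∷ (t ∷ ch) , (λ { (here e) → here e ; (there i) → there (there i) }) , shifts ys₁ xs
    insert {xs = xs} (_∷_ {xs = ys₁} {ys = ys₂} s ch) (there i) t =
      let js′ , zs , ch′ , sub , perm = insert ch i t
      in  _ , _ , s ∷ ch′ , (λ { (here e) → here e ; (there i) → there (sub i) }) ,
          ↭-trans (++⁺ˡ ys₁ perm) (shifts ys₁ xs)

    record Arc : Set where
      constructor arc
      field
        {start end} : Label
        {vertices}  : List (Fin n)
        isSeg       : Seg start end vertices
    open Arc

    ends : List Arc → List Label
    ends = concatMap (λ p → start p ∷ end p ∷ [])

    support : List Arc → List (Fin n)
    support = concatMap vertices

    -- An arc can be traversed in either direction, so an end `l` can always be taken as its start.
    extract : ∀ {l} ps → l ∈ ends ps → ∃ λ f → ∃ λ xs → ∃ λ ps′ →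
      Seg l f xs × ends ps ↭ l ∷ f ∷ ends ps′ × support ps ↭ xs ++ support ps′
    extract (p ∷ ps) (here refl)         = _ , _ , ps , isSeg p , ↭-refl , ↭-refl
    extract (p ∷ ps) (there (here refl)) =
      _ , _ , ps , seg-reverse (isSeg p) , swap _ _ ↭-refl , ++⁺ʳ (support ps) (↭-sym (↭-reverse (vertices p)))
    extract (p ∷ ps) (there (there i))   =
      let f , xs , ps′ , s , pe , pv = extract ps i
      in  f , xs , p ∷ ps′ , s ,
          ↭-trans (prep _ (prep _ pe)) (shifts (start p ∷ end p ∷ []) (_ ∷ f ∷ [])) ,
          ↭-trans (++⁺ˡ (vertices p) pv) (shifts (vertices p) xs)

    -- Arcs whose ends pair up into complementary labels can all be absorbed into a chain having
    -- these labels as junctions: two arcs with complementary ends are glued into one, and an arc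
    -- whose two ends are complementary is inserted at the corresponding junction.
    absorb : ∀ {a b js ys} es → All (_∈ js) es → ∀ ps → ends ps ↭ concatMap (λ e → e ∷ c e ∷ []) es →
      Chain a b js ys → ∃ λ js′ → ∃ λ zs → Chain a b js′ zs × zs ↭ support ps ++ ys
    absorb [] _ [] _ ch = _ , _ , ch , ↭-refl
    absorb [] _ (_ ∷ _) perm ch with () ← ↭-empty-inv perm
    absorb {ys = ys} (e ∷ es) (i ∷ is) ps perm ch =
      let f , xs , ps₁ , s , pe , pv = extract ps (∈-resp-↭ (↭-sym perm) (here refl))
          rest = drop-∷ (↭-trans (↭-sym pe) perm)
      in glue f xs ps₁ s pv rest (∈-resp-↭ (↭-sym rest) (here refl))
      where
      open PermutationReasoning
      glue : ∀ f xs ps₁ → Seg e f xs → support ps ↭ xs ++ support ps₁ →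
        f ∷ ends ps₁ ↭ c e ∷ concatMap (λ e → e ∷ c e ∷ []) es → c e ∈ f ∷ ends ps₁ →
        ∃ λ js′ → ∃ λ zs → Chain _ _ js′ zs × zs ↭ support ps ++ ys
      glue f xs ps₁ s pv rest (here refl) =
        let js₁ , ys₁ , ch₁ , sub , perm₁ = insert ch i (seg-reverse s)
            js₂ , zs , ch₂ , perm₂ = absorb es (All.map sub is) ps₁ (drop-∷ rest) ch₁
        in js₂ , zs , ch₂ , (begin
          zs                              ↭⟨ perm₂ ⟩
          support ps₁ ++ ys₁              ↭⟨ ++⁺ˡ (support ps₁) perm₁ ⟩
          support ps₁ ++ reverse xs ++ ys ↭⟨ ++⁺ˡ (support ps₁) (++⁺ʳ ys (↭-reverse xs)) ⟩
          support ps₁ ++ xs ++ ys         ↭⟨ shifts (support ps₁) xs ⟩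
          xs ++ support ps₁ ++ ys         ≡⟨ ++-assoc xs (support ps₁) ys ⟨
          (xs ++ support ps₁) ++ ys       ↭⟨ ++⁺ʳ ys pv ⟨
          support ps ++ ys                ∎)
      glue f xs ps₁ s pv rest (there j) =
        let f′ , xs′ , ps₂ , s′ , pe′ , pv′ = extract ps₁ j
            js₂ , zs , ch₂ , perm₂ = absorb es is (arc (seg-++ (seg-reverse s) s′) ∷ ps₂)
              (drop-∷ (↭-trans (swap _ _ ↭-refl) (↭-trans (↭-sym (prep f pe′)) rest))) ch
        in js₂ , zs , ch₂ , (begin
          zs                                        ↭⟨ perm₂ ⟩
          ((reverse xs ++ xs′) ++ support ps₂) ++ ys ≡⟨ cong (_++ ys) (++-assoc (reverse xs) xs′ (support ps₂)) ⟩
          (reverse xs ++ xs′ ++ support ps₂) ++ ys  ↭⟨ ++⁺ʳ ys (++⁺ (↭-reverse xs) (↭-sym pv′)) ⟩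
          (xs ++ support ps₁) ++ ys                 ↭⟨ ++⁺ʳ ys pv ⟨
          support ps ++ ys                          ∎)

  -- Disjoint intervals with both ends in prescribed sets

  minimum-first : ∀ {I : Set} (w : I → ℕ) x xs →
    ∃ λ y → ∃ λ ys → x ∷ xs ↭ y ∷ ys × All (λ z → w y ≤ w z) ys
  minimum-first w x []        = x , [] , ↭-refl , []
  minimum-first w x (x′ ∷ xs) with minimum-first w x′ xs
  ... | y , ys , perm , least with ≤-total (w x) (w y)
  ...   | inj₁ x≤y = x , y ∷ ys , prep x perm , x≤y ∷ All.map (≤-trans x≤y) least
  ...   | inj₂ y≤x = y , x ∷ ys , ↭-trans (prep x perm) (swap x y ↭-refl) , y≤x ∷ least

  module Separation {S : Set} (P : S → ℕ → Set) where

    data Separated (a : ℕ) : List (S × ℕ × ℕ) → Set where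
      []  : Separated a []
      _∷_ : ∀ {σ p q bs} → a ≤ p × p < q × P σ p × P σ q → Separated (suc q) bs →
            Separated a ((σ , p , q) ∷ bs)

    -- The supply of a set while `k` sets are still to be served: every round costs it at most two
    -- elements.
    Stock : ℕ → ℕ → S × List ℕ → Set
    Stock k a (σ , xs) = All (a ≤_) xs × AllPairs _<_ xs × All (P σ) xs × k * 2 ≤ length xs

    -- The value `0` is a default for short lists, which `Stock (suc k)` excludes.
    second : List ℕ → ℕ
    second (_ ∷ q ∷ _) = q
    second _           = 0

    drop₂ : S × List ℕ → S × List ℕ
    drop₂ (σ , _ ∷ _ ∷ xs) = σ , xs
    drop₂ (σ , _)          = σ , []

    drop₂-proj₁ : ∀ ys → map proj₁ (map drop₂ ys) ≡ map proj₁ ys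
    drop₂-proj₁ []                        = refl
    drop₂-proj₁ ((σ , []) ∷ ys)           = cong (σ ∷_) (drop₂-proj₁ ys)
    drop₂-proj₁ ((σ , _ ∷ []) ∷ ys)       = cong (σ ∷_) (drop₂-proj₁ ys)
    drop₂-proj₁ ((σ , _ ∷ _ ∷ _) ∷ ys)    = cong (σ ∷_) (drop₂-proj₁ ys)

    -- From the third on, all elements exceed the second one and therefore `q`.
    drop₂-Stock : ∀ {k a q} z → Stock (suc k) a z → q ≤ second (proj₂ z) → Stock k (suc q) (drop₂ z)
    drop₂-Stock (σ , p′ ∷ q′ ∷ xs) (_ , (_ ∷ (q′< ∷ inc)) , (_ ∷ _ ∷ Ps) , len) q≤q′ =
      All.map (≤-trans (s≤s q≤q′)) q′< , inc , Ps , ≤-pred (≤-pred len)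
    drop₂-Stock (σ , [])     (_ , _ , _ , ()) _
    drop₂-Stock (σ , _ ∷ []) (_ , _ , _ , s≤s ()) _

    -- The set whose second element is smallest comes first; every other set
    -- loses only its two smallest elements.
    separate : ∀ k a L → length L ≡ k → All (Stock k a) L →
               ∃ λ bs → map proj₁ bs ↭ map proj₁ L × Separated a bs
    separate zero    a []      _   _      = [] , ↭-refl , []
    separate (suc k) a (x ∷ L) len stocks with minimum-first (second ∘ proj₂) x L
    ... | y , ys , perm , least with All-resp-↭ perm stocks
    ... | sy ∷ sys = first y (↭-length perm) (map⁺ proj₁ perm) least sy
      where
      first : ∀ y → suc (length L) ≡ suc (length ys) → map proj₁ (x ∷ L) ↭ map proj₁ (y ∷ ys) →
        All (λ z → second (proj₂ y) ≤ second (proj₂ z)) ys → Stock (suc k) a y →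
        ∃ λ bs → map proj₁ bs ↭ map proj₁ (x ∷ L) × Separated a bs
      first (σ , []) _ _ _ (_ , _ , _ , ())
      first (σ , _ ∷ []) _ _ _ (_ , _ , _ , s≤s ())
      first (σ , p ∷ q ∷ xs) len′ perm′ least′ ((a≤p ∷ _) , ((p<q ∷ _) ∷ _) , (Pp ∷ Pq ∷ _) , _) =
        let bs , perm₁ , sep = separate k (suc q) (map drop₂ ys)
              (trans (length-map drop₂ ys) (suc-injective (trans (sym len′) len)))
              (AllP.map⁺ (All.zipWith (λ {z} (s , l) → drop₂-Stock {k} {a} z s l) (sys , least′)))
        in (σ , p , q) ∷ bs ,
           ↭-trans (prep σ (↭-trans perm₁ (↭-reflexive (drop₂-proj₁ ys)))) (↭-sym perm′) ,
           (a≤p , p<q , Pp , Pq) ∷ sep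

  -- Intervals of a sequence, repeated lists and periodic points

  slice : ∀ {A : Set} → (ℕ → A) → ℕ → ℕ → List A
  slice f a zero    = []
  slice f a (suc l) = f a ∷ slice f (suc a) l

  slice-++ : ∀ {A : Set} (f : ℕ → A) a l l′ → slice f a l ++ slice f (a + l) l′ ≡ slice f a (l + l′)
  slice-++ f a zero    l′ = cong (λ b → slice f b l′) (+-identityʳ a)
  slice-++ f a (suc l) l′ = cong (f a ∷_)
    (trans (cong (λ b → slice f (suc a) l ++ slice f b l′) (+-suc a l)) (slice-++ f (suc a) l l′))

  -- The half-open interval `(p , q]`, since cuts are made after positions.
  between : ∀ {A : Set} → (ℕ → A) → ℕ → ℕ → List A
  between f p q = slice f (suc p) (q ∸ p)

  between-++ : ∀ {A : Set} (f : ℕ → A) {p q s} → p ≤ q → q ≤ s → between f p q ++ between f q s ≡ between f p s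
  between-++ f {p} {q} {s} p≤q q≤s = begin
    slice f (suc p) (q ∸ p) ++ slice f (suc q) (s ∸ q)
      ≡⟨ cong (λ b → slice f (suc p) (q ∸ p) ++ slice f (suc b) (s ∸ q)) (m+[n∸m]≡n p≤q) ⟨
    slice f (suc p) (q ∸ p) ++ slice f (suc p + (q ∸ p)) (s ∸ q) ≡⟨ slice-++ f (suc p) (q ∸ p) (s ∸ q) ⟩
    slice f (suc p) (q ∸ p + (s ∸ q))
      ≡⟨ cong (slice f (suc p)) (trans (+-comm (q ∸ p) (s ∸ q)) (trans (sym (+-∸-assoc (s ∸ q) p≤q)) (cong (_∸ p) (m∸n+n≡m q≤s)))) ⟩
    slice f (suc p) (s ∸ p) ∎
    where open ≡-Reasoning

  concatMap-↭ : ∀ {A B : Set} (f : A → List B) {xs ys} → xs ↭ ys → concatMap f xs ↭ concatMap f ys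
  concatMap-↭ f _↭_.refl          = ↭-refl
  concatMap-↭ f (prep x p)        = ++⁺ˡ (f x) (concatMap-↭ f p)
  concatMap-↭ f (swap x y p)      = ↭-trans (shifts (f x) (f y)) (++⁺ˡ (f y) (++⁺ˡ (f x) (concatMap-↭ f p)))
  concatMap-↭ f (_↭_.trans p q)   = ↭-trans (concatMap-↭ f p) (concatMap-↭ f q)

  map-≡-++ : ∀ {A B : Set} (f : A → B) zs xs {ys} → map f zs ≡ xs ++ ys →
    ∃ λ zs₁ → ∃ λ zs₂ → zs ≡ zs₁ ++ zs₂ × map f zs₁ ≡ xs × map f zs₂ ≡ ys
  map-≡-++ f zs       []       eq = [] , zs , refl , refl , eq
  map-≡-++ f (z ∷ zs) (x ∷ xs) eq =
    let e , es = ∷-injective eq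
        zs₁ , zs₂ , e₁ , e₂ , e₃ = map-≡-++ f zs xs es
    in z ∷ zs₁ , zs₂ , cong (z ∷_) e₁ , cong₂ _∷_ e e₂ , e₃

  Unique-++⁻ : ∀ {A : Set} (xs : List A) {ys} → Unique (xs ++ ys) → Unique xs × Unique ys
  Unique-++⁻ []       u       = [] , u
  Unique-++⁻ (x ∷ xs) (d ∷ u) = let ux , uy = Unique-++⁻ xs u in AllP.++⁻ˡ xs d ∷ ux , uy

  All-repeated : ∀ {A : Set} k (xs : List A) → All (_∈ xs) (concat (replicate k xs))
  All-repeated zero    xs = []
  All-repeated (suc k) xs = AllP.++⁺ (All.tabulate id) (All-repeated k xs)

  length-repeated : ∀ {A : Set} k (xs : List A) → length (concat (replicate k xs)) ≡ k * length xs
  length-repeated zero    xs = refl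
  length-repeated (suc k) xs = trans (length-++ xs) (cong (length xs +_) (length-repeated k xs))

  iterate : ∀ {A : Set} → (A → A) → ℕ → A → A
  iterate g zero    x = x
  iterate g (suc k) x = iterate g k (g x)

  iterate-+ : ∀ {A : Set} (g : A → A) a b x → iterate g (a + b) x ≡ iterate g b (iterate g a x)
  iterate-+ g zero    b x = refl
  iterate-+ g (suc a) b x = iterate-+ g a b (g x)

  -- Two of the first `Q + 1` iterates of `x₀` coincide, and the earlier one is periodic.
  periodic-point : ∀ {Q} → (g : Fin Q → Fin Q) → Fin Q → ∃ λ w → ∃ λ ℓ → 0 < ℓ × ℓ ≤ Q × iterate g ℓ w ≡ w
  periodic-point {Q} g x₀ with pigeonhole (n<1+n Q) (λ i → iterate g (toℕ i) x₀)
  ... | i , j , i<j , eq = iterate g (toℕ i) x₀ , toℕ j ∸ toℕ i , m<n⇒0<n∸m i<j ,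
    ≤-trans (m∸n≤m (toℕ j) (toℕ i)) (≤-pred (toℕ<n j)) ,
    trans (sym (iterate-+ g (toℕ i) (toℕ j ∸ toℕ i) x₀))
          (trans (cong (λ k → iterate g k x₀) (m+[n∸m]≡n (<⇒≤ i<j))) (sym eq))

  -- From clusters of positions to a 2-factor

  module Assembly {N : ℕ} (G : Graph (suc N)) (h : ℕ → Fin (suc N))
    (step : ∀ i → i < N → Adj G (h i) (h (suc i))) (wrap : Adj G (h N) (h 0))
    (cover : slice h 0 (suc N) ↭ allFin (suc N))
    {Q : ℕ} (U V : Fin Q → List ℕ) (r b : Fin Q → Fin Q)
    (red  : ∀ i {p q} → p ∈ U i → q ∈ V (r i) → Adj G (h p) (h q))
    (blue : ∀ j {p q} → p ∈ V j → q ∈ U (b j) → Adj G (h (suc p)) (h (suc q))) where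

    g : Fin Q → Fin Q
    g w = b (r w)

    -- A label is one side of an edge class, the `Bool` telling which. Both kinds are indexed by the
    -- place `w` on the walk: `rd w` is the red class at `U w`, and `bl w` the blue class at
    -- `V (r w)` that follows it.
    data Label : Set where
      rd bl : Fin Q → Bool → Label

    c : Label → Label
    c (rd w s) = rd w (not s)
    c (bl w s) = bl w (not s)

    Has : Label → Fin (suc N) → Set
    Has (rd w false) v = ∃ λ p → p ∈ U w × v ≡ h p
    Has (rd w true)  v = ∃ λ p → p ∈ V (r w) × v ≡ h p
    Has (bl w false) v = ∃ λ p → p ∈ V (r w) × v ≡ h (suc p)
    Has (bl w true)  v = ∃ λ p → p ∈ U (g w) × v ≡ h (suc p)

    c-adj : ∀ {l u v} → Has l u → Has (c l) v → Adj G u v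
    c-adj {rd w false} (p , p∈ , refl) (q , q∈ , refl) = red w p∈ q∈
    c-adj {rd w true}  (p , p∈ , refl) (q , q∈ , refl) = Paths.Adj-sym G (red w q∈ p∈)
    c-adj {bl w false} (p , p∈ , refl) (q , q∈ , refl) = blue (r w) p∈ q∈
    c-adj {bl w true}  (p , p∈ , refl) (q , q∈ , refl) = Paths.Adj-sym G (blue (r w) q∈ p∈)

    open Chains G Label c Has (λ {l} → c-adj {l})

    -- A visit of the closed walk w, r w, g w, r (g w), … to a cluster: Y w is the visit to
    -- V (r w) reached by red, X w the following visit to U (g w) reached by blue.
    data Station : Set where
      Y X : Fin Q → Station

    cluster : Station → List ℕ
    cluster (Y w) = V (r w)
    cluster (X w) = U (g w)

    -- A cut after a position `p` of the cluster leaves the end `h p` with a red label and the end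
    -- `h (suc p)` with a blue one. At `Y w` the walk arrives by red and departs by blue, at `X w`
    -- conversely.
    ρ β : Station → Label
    ρ (Y w) = rd w true
    ρ (X w) = rd (g w) false
    β (Y w) = bl w false
    β (X w) = bl w true

    hasρ : ∀ σ {p} → p ∈ cluster σ → Has (ρ σ) (h p)
    hasρ (Y w) p∈ = _ , p∈ , refl
    hasρ (X w) p∈ = _ , p∈ , refl

    hasβ : ∀ σ {p} → p ∈ cluster σ → Has (β σ) (h (suc p))
    hasβ (Y w) p∈ = _ , p∈ , refl
    hasβ (X w) p∈ = _ , p∈ , refl

    walk : Fin Q → ℕ → List Station
    walk w zero    = []
    walk w (suc ℓ) = Y w ∷ X w ∷ walk (g w) ℓ

    junctions : Fin Q → ℕ → List Label
    junctions w zero    = []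
    junctions w (suc ℓ) = bl w false ∷ rd (g w) false ∷ junctions (g w) ℓ

    length-walk : ∀ w ℓ → length (walk w ℓ) ≡ ℓ * 2
    length-walk w zero    = refl
    length-walk w (suc ℓ) = cong (2 +_) (length-walk (g w) ℓ)

    length-junctions : ∀ w ℓ → length (junctions w ℓ) ≡ ℓ * 2
    length-junctions w zero    = refl
    length-junctions w (suc ℓ) = cong (2 +_) (length-junctions (g w) ℓ)

    slice-path : ∀ a l → a + l ≤ N → Path (h a) (h (a + l)) (slice h a (suc l))
    slice-path a zero    _  = subst (λ b → Path (h a) (h b) (h a ∷ [])) (sym (+-identityʳ a)) [-]
    slice-path a (suc l) le rewrite +-suc a l =
      step a (≤-trans (s≤s (m≤m+n a l)) le) ∷ slice-path (suc a) l le

    between-path : ∀ {p q} → p < q → q ≤ N → Path (h (suc p)) (h q) (between h p q)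
    between-path {p} p<q q≤N with m≤n⇒∃[o]m+o≡n p<q
    ... | d , refl = subst (λ l → Path (h (suc p)) (h (suc p + d)) (slice h (suc p) l))
      (sym (trans (+-∸-assoc 1 (m≤m+n p d)) (cong suc (m+n∸m≡n p d)))) (slice-path (suc p) d q≤N)

    Block : Set
    Block = Station × ℕ × ℕ

    -- With `p < N` the vertex `h (suc p)` still lies on the list, so the edge from `h N` to `h 0`
    -- is never cut.
    open Separation (λ σ p → p ∈ cluster σ × p < N)

    small : Block → List (Fin (suc N))
    small (σ , p , q) = between h p q

    Valid : Block → Set
    Valid (σ , p , q) = Seg (β σ) (ρ σ) (between h p q)

    separated⇒valid : ∀ {a bs} → Separated a bs → All Valid bs
    separated⇒valid [] = []
    separated⇒valid (_∷_ {σ} (_ , p<q , (p∈ , _) , (q∈ , q<N)) sep) =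
      seg (hasβ σ p∈) (hasρ σ q∈) (between-path p<q (<⇒≤ q<N)) ∷ separated⇒valid sep

    -- An arc cut out at a station runs from blue to red. It is reversed at every `Y`, where the
    -- walk enters by red, and kept at every `X`, so consecutive arcs meet in complementary labels.
    small-chain : ∀ w ℓ bs → map proj₁ bs ≡ walk w ℓ → All Valid bs →
      ∃ λ xs → Chain (rd w false) (rd (iterate g ℓ w) false) (junctions w ℓ) xs × xs ↭ concatMap small bs
    small-chain w zero    []       _    _ = [] , [] , ↭-refl
    small-chain w (suc ℓ) (b₁ ∷ b₂ ∷ bs) eq (v₁ ∷ v₂ ∷ vs)
      with refl , eq₂ ← ∷-injective eq with refl , eq₃ ← ∷-injective eq₂ =
      let xs , ch , perm = small-chain (g w) ℓ bs eq₃ vs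
      in  _ , seg-reverse v₁ ∷ (v₂ ∷ ch) , ++⁺ (↭-reverse (small b₁)) (++⁺ˡ (small b₂) perm)

    small-chains : ∀ k w ℓ bs → iterate g ℓ w ≡ w → map proj₁ bs ≡ concat (replicate k (walk w ℓ)) → All Valid bs →
      ∃ λ (css : Vec (List (Fin (suc N))) k) →
        VAll.All (Chain (rd w false) (rd w false) (junctions w ℓ)) css × concat (toList css) ↭ concatMap small bs
    small-chains zero    w ℓ []  per eq vs = [] , [] , ↭-refl
    small-chains (suc k) w ℓ bs per eq vs with map-≡-++ proj₁ bs (walk w ℓ) eq
    ... | bs₁ , bs₂ , refl , eq₁ , eq₂ =
      let xs , ch , perm = small-chain w ℓ bs₁ eq₁ (AllP.++⁻ˡ bs₁ vs)
          css , chs , perms = small-chains k w ℓ bs₂ per eq₂ (AllP.++⁻ʳ bs₁ vs)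
      in xs ∷ css , subst (λ w′ → Chain (rd w false) (rd w′ false) (junctions w ℓ) xs) per ch ∷ chs ,
         ↭-trans (++⁺ perm perms) (↭-reflexive (sym (concatMap-++ small bs₁ bs₂)))

    stationEnds : Station → List Label
    stationEnds σ = ρ σ ∷ β σ ∷ []

    pair : Label → List Label
    pair l = l ∷ c l ∷ []

    -- A telescoping count: the two sides of each red class belong to neighbouring stations, so
    -- grouping by station and grouping by class differ only by one label at either end of the walk.
    -- On a closed walk these two labels agree and cancel.
    walk-ends : ∀ w ℓ → concatMap stationEnds (walk w ℓ) ++ rd (iterate g ℓ w) true ∷ [] ↭
                        rd w true ∷ concatMap pair (junctions w ℓ)
    walk-ends w zero    = ↭-refl
    walk-ends w (suc ℓ) = prep _ (prep _ (↭-trans (swap _ _ (walk-ends (g w) ℓ)) ↭-refl))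

    closed-walk-ends : ∀ w ℓ → iterate g ℓ w ≡ w →
      concatMap stationEnds (walk w ℓ) ↭ concatMap pair (junctions w ℓ)
    closed-walk-ends w ℓ per = drop-∷ (↭-trans (∷↭∷ʳ (rd w true) _)
      (subst (λ w′ → concatMap stationEnds (walk w ℓ) ++ rd w′ true ∷ [] ↭ rd w true ∷ concatMap pair (junctions w ℓ))
        per (walk-ends w ℓ)))

    repeated-walk-ends : ∀ k w ℓ → iterate g ℓ w ≡ w →
      concatMap stationEnds (concat (replicate k (walk w ℓ))) ↭ concatMap pair (concat (replicate k (junctions w ℓ)))
    repeated-walk-ends zero    w ℓ per = ↭-refl
    repeated-walk-ends (suc k) w ℓ per = ↭-trans (↭-reflexive (concatMap-++ stationEnds (walk w ℓ) _))
      (↭-trans (++⁺ (closed-walk-ends w ℓ per) (repeated-walk-ends k w ℓ per))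
               (↭-reflexive (sym (concatMap-++ pair (junctions w ℓ) _))))

    -- Cutting out a block leaves `h p` with label `ρ` as the end of one arc and `h (suc q)` with
    -- label `β` as the start of the next. The last arc crosses the edge from `h N` and continues
    -- along `zs`.
    gaps : ∀ {σ₀ q₀ bs x e zs y} → q₀ ∈ cluster σ₀ × q₀ < N → Separated (suc q₀) bs →
      Adj G (h N) x → Has e y → Path x y zs →
      ∃ λ ps → ends ps ≡ β σ₀ ∷ concatMap stationEnds (map proj₁ bs) ++ e ∷ [] ×
               support ps ++ concatMap small bs ↭ between h q₀ N ++ zs
    gaps {σ₀} {q₀} {zs = zs} (q₀∈ , q₀<N) [] a he tail =
      arc (seg (hasβ σ₀ q₀∈) he (path-++ (between-path q₀<N ≤-refl) a tail)) ∷ [] , refl ,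
      ↭-reflexive (trans (++-identityʳ _) (++-identityʳ _))
    gaps {σ₀} {q₀} {zs = zs} (q₀∈ , q₀<N) (_∷_ {σ} {p} {q} {bs} (q₀<p , p<q , (p∈ , p<N) , (q∈ , q<N)) sep) a he tail =
      let ps , es , perm = gaps {σ} {q} {bs} (q∈ , q<N) sep a he tail
          open PermutationReasoning
      in arc (seg (hasβ σ₀ q₀∈) (hasρ σ p∈) (between-path q₀<p (<⇒≤ p<N))) ∷ ps ,
         cong (λ l → β σ₀ ∷ ρ σ ∷ l) es , (begin
         (between h q₀ p ++ support ps) ++ between h p q ++ concatMap small bs
           ≡⟨ ++-assoc (between h q₀ p) (support ps) _ ⟩
         between h q₀ p ++ support ps ++ between h p q ++ concatMap small bs
           ↭⟨ ++⁺ˡ (between h q₀ p) (shifts (support ps) (between h p q)) ⟩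
         between h q₀ p ++ between h p q ++ support ps ++ concatMap small bs
           ↭⟨ ++⁺ˡ (between h q₀ p) (++⁺ˡ (between h p q) perm) ⟩
         between h q₀ p ++ between h p q ++ between h q N ++ zs
           ≡⟨ cong (between h q₀ p ++_) (++-assoc (between h p q) (between h q N) zs) ⟨
         between h q₀ p ++ (between h p q ++ between h q N) ++ zs
           ≡⟨ cong (λ l → between h q₀ p ++ l ++ zs) (between-++ h (<⇒≤ p<q) (<⇒≤ q<N)) ⟩
         between h q₀ p ++ between h p N ++ zs
           ≡⟨ ++-assoc (between h q₀ p) (between h p N) zs ⟨
         (between h q₀ p ++ between h p N) ++ zs
           ≡⟨ cong (_++ zs) (between-++ h (<⇒≤ q₀<p) (<⇒≤ p<N)) ⟩
         between h q₀ N ++ zs ∎)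

    big-arcs : ∀ {β₀ bs} → Separated 0 (β₀ ∷ bs) →
      ∃ λ ps → ends ps ↭ concatMap stationEnds (map proj₁ (β₀ ∷ bs)) ×
               support ps ++ concatMap small (β₀ ∷ bs) ↭ allFin (suc N)
    big-arcs {σ , p , q} {bs} ((_ , p<q , (p∈ , p<N) , (q∈ , q<N)) ∷ sep) =
      -- The last arc ends where the first block begins: its tail runs from `h 0` to `h p`.
      let ps , es , perm = gaps {σ} {q} {bs} (q∈ , q<N) sep wrap (hasρ σ p∈) (slice-path 0 p (<⇒≤ p<N))
          open PermutationReasoning
      in ps , ↭-trans (↭-reflexive es) (↭-sym (∷↭∷ʳ (ρ σ) _)) , (begin
         support ps ++ between h p q ++ concatMap small bs ↭⟨ shifts (support ps) (between h p q) ⟩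
         between h p q ++ support ps ++ concatMap small bs ↭⟨ ++⁺ˡ (between h p q) perm ⟩
         between h p q ++ between h q N ++ slice h 0 (suc p) ≡⟨ ++-assoc (between h p q) (between h q N) _ ⟨
         (between h p q ++ between h q N) ++ slice h 0 (suc p)
           ≡⟨ cong (_++ slice h 0 (suc p)) (between-++ h (<⇒≤ p<q) (<⇒≤ q<N)) ⟩
         between h p N ++ slice h 0 (suc p) ↭⟨ ++-comm (between h p N) _ ⟩
         slice h 0 (suc p) ++ between h p N ≡⟨ slice-++ h 0 (suc p) (N ∸ p) ⟩
         slice h 0 (suc p + (N ∸ p)) ≡⟨ cong (slice h 0 ∘ suc) (m+[n∸m]≡n (<⇒≤ p<N)) ⟩
         slice h 0 (suc N) ↭⟨ cover ⟩
         allFin (suc N) ∎)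

    closed-chains⇒cycles : ∀ {k a} (css : Vec (List (Fin (suc N))) k) →
      VAll.All (λ xs → 3 ≤ length xs × ∃ λ js → Chain a a js xs) css →
      Unique (concat (toList css)) → VAll.All (IsCycle G) css
    closed-chains⇒cycles []         []                     u = []
    closed-chains⇒cycles (xs ∷ css) ((len , _ , ch) ∷ chs) u =
      let u₁ , u₂ = Unique-++⁻ xs u in closed-chain⇒IsCycle ch len u₁ ∷ closed-chains⇒cycles css chs u₂

    -- All rounds have the same junction labels, so the first chain alone has a junction for every
    -- pair of ends. It absorbs all arcs left over, while the other `k` chains stay as they are.
    blocks⇒two-factor : ∀ k w ℓ bs → 2 ≤ ℓ → iterate g ℓ w ≡ w →
      map proj₁ bs ↭ concat (replicate (suc k) (walk w ℓ)) → Separated 0 bs → TwoFactorWith G (suc k)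
    blocks⇒two-factor k w (suc ℓ) [] _ per perm _ with () ← ↭-length perm
    blocks⇒two-factor k w ℓ bs@(_ ∷ _) 2≤ℓ per perm sep
      with bs′ , eq , bs↭bs′ ← ↭-map-inv proj₁ perm
      with small-chains (suc k) w ℓ bs′ per (sym eq) (All-resp-↭ bs↭bs′ (separated⇒valid sep))
    ... | xs ∷ css , ch ∷ chs , smalls =
      let ps , pe , pv = big-arcs sep
          js , zs , ch′ , zs↭ = absorb (concat (replicate (suc k) (junctions w ℓ)))
            (All-repeated (suc k) (junctions w ℓ)) ps
            (↭-trans pe (↭-trans (concatMap-↭ stationEnds perm) (repeated-walk-ends (suc k) w ℓ per))) ch
          total : concat (toList (zs ∷ css)) ↭ allFin (suc N)
          total = begin
            zs ++ concat (toList css)                  ↭⟨ ++⁺ʳ (concat (toList css)) zs↭ ⟩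
            (support ps ++ xs) ++ concat (toList css)  ≡⟨ ++-assoc (support ps) xs _ ⟩
            support ps ++ xs ++ concat (toList css)    ↭⟨ ++⁺ˡ (support ps) smalls ⟩
            support ps ++ concatMap small bs′          ↭⟨ ++⁺ˡ (support ps) (concatMap-↭ small bs↭bs′) ⟨
            support ps ++ concatMap small bs           ↭⟨ pv ⟩
            allFin (suc N)                             ∎
          unique = Unique-resp-↭ (setoid _) (↭⇒↭ₛ (↭-sym total)) (allFin⁺ (suc N))
          len-zs = ≤-trans (long ch) (≤-trans (m≤n+m (length xs) (length (support ps)))
                     (≤-reflexive (trans (sym (length-++ (support ps))) (sym (↭-length zs↭)))))
      in zs ∷ css ,
         closed-chains⇒cycles (zs ∷ css) ((len-zs , _ , ch′) ∷ VAll.map (λ ch → long ch , _ , ch) chs) unique ,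
         total
      where
      open PermutationReasoning
      -- A round has `2 * ℓ ≥ 4` junctions, each ending a nonempty segment.
      long : ∀ {a xs} → Chain a a (junctions w ℓ) xs → 3 ≤ length xs
      long ch = ≤-trans (≤-trans (n≤1+n 3) (≤-trans (*-monoˡ-≤ 2 2≤ℓ) (≤-reflexive (sym (length-junctions w ℓ)))))
                        (chain-length ch)

    -- The cluster size allows for `suc k` rounds of at most `Q + Q` steps with two stations each,
    -- and two elements spent per station.
    two-factor : ∀ k → Fin Q → (∀ i → AllPairs _<_ (U i) × All (_< N) (U i) × suc k * (Q + Q) * 2 * 2 ≤ length (U i)) →
      (∀ i → AllPairs _<_ (V i) × All (_< N) (V i) × suc k * (Q + Q) * 2 * 2 ≤ length (V i)) → TwoFactorWith G (suc k)
    two-factor k i₀ stockU stockV with periodic-point g i₀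
    ... | w , ℓ , ℓ>0 , ℓ≤Q , per =
      let bs , perm , sep = separate (length L) 0 L refl (AllP.map⁺ (All.universal stock _))
      -- The period is run through twice: for `ℓ = 1` a single run could give a closed chain of only
      -- two vertices.
      in blocks⇒two-factor k w (ℓ + ℓ) bs (+-mono-≤ ℓ>0 ℓ>0)
           (trans (iterate-+ g ℓ ℓ w) (trans (cong (iterate g ℓ) per) per))
           (↭-trans perm (↭-reflexive (trans (sym (map-∘ stations)) (map-id stations)))) sep
      where
      stations = concat (replicate (suc k) (walk w (ℓ + ℓ)))
      L = map (λ σ → σ , cluster σ) stations
      bound : length L * 2 ≤ suc k * (Q + Q) * 2 * 2
      bound = *-monoˡ-≤ 2 (≤-trans (≤-reflexive (trans (length-map _ stations)
        (trans (length-repeated (suc k) (walk w (ℓ + ℓ))) (trans (cong (suc k *_) (length-walk w (ℓ + ℓ))) (sym (*-assoc (suc k) (ℓ + ℓ) 2))))))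
        (*-monoˡ-≤ 2 (*-monoʳ-≤ (suc k) (+-mono-≤ ℓ≤Q ℓ≤Q))))
      from : ∀ σ → AllPairs _<_ (cluster σ) × All (_< N) (cluster σ) × suc k * (Q + Q) * 2 * 2 ≤ length (cluster σ) →
             Stock (length L) 0 (σ , cluster σ)
      from σ (inc , lt , len) = All.universal (λ _ → z≤n) _ , inc , All.tabulate (λ i → i , All.lookup lt i) , ≤-trans bound len
      stock : ∀ σ → Stock (length L) 0 (σ , cluster σ)
      stock (Y w) = from (Y w) (stockV (r w))
      stock (X w) = from (X w) (stockU (g w))

-- Positions on the Hamilton cycle, degrees and the choice of constants

open Density
open Surgery
import Data.Nat as ℕ
import Data.Nat.Properties as ℕP
open import Data.Integer using (+_; -[1+_]; +<+)
import Data.Integer as ℤ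
import Data.Integer.Properties as ℤP
open import Data.Rational using (ℚ; mkℚ; 0ℚ; _<_; _≤_; _*_; _/_; *<*; toℚᵘ)
import Data.Rational.Properties as ℚP
import Data.Rational.Unnormalised as ℚᵘ
open ℚᵘ using (mkℚᵘ)
import Data.Rational.Unnormalised.Properties as ℚᵘP

nth : A → List A → ℕ → A
nth d []       i       = d
nth d (x ∷ xs) zero    = x
nth d (x ∷ xs) (suc i) = nth d xs i

slice-suc : ∀ (f : ℕ → A) a l → slice f (suc a) l ≡ slice (f ∘ suc) a l
slice-suc f a zero    = refl
slice-suc f a (suc l) = cong (f (suc a) ∷_) (slice-suc f (suc a) l)

slice-nth : ∀ (d : A) xs → slice (nth d xs) 0 (length xs) ≡ xs
slice-nth d []       = refl
slice-nth d (x ∷ xs) = cong (x ∷_) (trans (slice-suc (nth d (x ∷ xs)) 0 (length xs)) (slice-nth d xs))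

slice-map : ∀ (f : ℕ → A) a l → slice f a l ≡ map f (slice id a l)
slice-map f a zero    = refl
slice-map f a (suc l) = cong (f a ∷_) (slice-map f (suc a) l)

length-slice : ∀ (f : ℕ → A) a l → length (slice f a l) ≡ l
length-slice f a zero    = refl
length-slice f a (suc l) = cong suc (length-slice f (suc a) l)

slice-≥ : ∀ a l → All (a ℕ.≤_) (slice id a l)
slice-≥ a zero    = []
slice-≥ a (suc l) = ℕP.≤-refl ∷ All.map (ℕP.≤-trans (ℕP.n≤1+n a)) (slice-≥ (suc a) l)

slice-< : ∀ a l → All (ℕ._< a ℕ.+ l) (slice id a l)
slice-< a zero    = []
slice-< a (suc l) rewrite ℕP.+-suc a l = ℕ.s≤s (ℕP.m≤m+n a l) ∷ slice-< (suc a) l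

slice-increasing : ∀ a l → AllPairs ℕ._<_ (slice id a l)
slice-increasing a zero    = []
slice-increasing a (suc l) = slice-≥ (suc a) l ∷ slice-increasing (suc a) l

AllPairs-resp-⊆ : ∀ {R : A → A → Set} {xs ys} → xs ⊆ ys → AllPairs R ys → AllPairs R xs
AllPairs-resp-⊆ []         []       = []
AllPairs-resp-⊆ (y ∷ʳ s)   (_ ∷ rs) = AllPairs-resp-⊆ s rs
AllPairs-resp-⊆ (refl ∷ s) (r ∷ rs) = All-resp-⊆ s r ∷ AllPairs-resp-⊆ s rs

∑-↭ : ∀ {xs ys : List A} (f : A → ℕ) → xs ↭ ys → ∑ xs f ≡ ∑ ys f
∑-↭ f _↭_.refl        = refl
∑-↭ f (prep x p)      = cong (f x ℕ.+_) (∑-↭ f p)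
∑-↭ {xs = _ ∷ _ ∷ xs} {_ ∷ _ ∷ ys} f (swap x y p) = trans (lem (f x) (f y) (∑ xs f)) (cong (λ s → f y ℕ.+ (f x ℕ.+ s)) (∑-↭ f p))
  where
  lem : ∀ a b c → a ℕ.+ (b ℕ.+ c) ≡ b ℕ.+ (a ℕ.+ c)
  lem = solve 3 (λ a b c → a :+ (b :+ c) := b :+ (a :+ c)) refl where open +-*-Solver
∑-↭ f (_↭_.trans p q) = trans (∑-↭ f p) (∑-↭ f q)

∑-sum : ∀ (xs : List A) f → sum (map f xs) ≡ ∑ xs f
∑-sum []       f = refl
∑-sum (x ∷ xs) f = cong (f x ℕ.+_) (∑-sum xs f)

module HamiltonianCycle {N : ℕ} (G : Graph (suc N)) (h : ℕ → Fin (suc N))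
  (cover : slice h 0 (suc N) ↭ allFin (suc N)) where
  open Graph G using (adj)

  deg-∑ : ∀ v → deg G v ≡ ∑ (slice h 0 (suc N)) (⟦_⟧ ∘ adj v)
  deg-∑ v = trans (∑-sum (allFin (suc N)) _) (sym (∑-↭ _ cover))

  -- Positions stop before `N`, so that `h (suc q)` exists; only the neighbour `h N` can be missed.
  deg-red : ∀ v → deg G v ℕ.≤ suc (∑ (slice id 0 N) (λ q → ⟦ adj v (h q) ⟧))
  deg-red v = begin
    deg G v                                      ≡⟨ deg-∑ v ⟩
    ∑ (slice h 0 (suc N)) f                      ≡⟨ cong (λ l → ∑ (slice h 0 l) f) (ℕP.+-comm N 1) ⟨
    ∑ (slice h 0 (N ℕ.+ 1)) f                    ≡⟨ cong (λ xs → ∑ xs f) (slice-++ h 0 N 1) ⟨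
    ∑ (slice h 0 N ++ h N ∷ []) f                ≡⟨ ∑-++ (slice h 0 N) (h N ∷ []) f ⟩
    ∑ (slice h 0 N) f ℕ.+ (f (h N) ℕ.+ 0)        ≡⟨ cong₂ ℕ._+_ (trans (cong (λ xs → ∑ xs f) (slice-map h 0 N)) (∑-map h (slice id 0 N) f)) (ℕP.+-identityʳ _) ⟩
    ∑ (slice id 0 N) (f ∘ h) ℕ.+ f (h N)         ≤⟨ ℕP.+-monoʳ-≤ (∑ (slice id 0 N) (f ∘ h)) (⟦⟧≤1 (adj v (h N))) ⟩
    ∑ (slice id 0 N) (f ∘ h) ℕ.+ 1               ≡⟨ ℕP.+-comm _ 1 ⟩
    suc (∑ (slice id 0 N) (f ∘ h))               ∎
    where
    open ℕP.≤-Reasoning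
    f : Fin (suc N) → ℕ
    f u = ⟦ adj v u ⟧

  -- Here the successors run from `h 1` to `h N`, and only `h 0` can be missed.
  deg-blue : ∀ v → deg G v ℕ.≤ suc (∑ (slice id 0 N) (λ q → ⟦ adj v (h (suc q)) ⟧))
  deg-blue v = begin
    deg G v                                      ≡⟨ deg-∑ v ⟩
    f (h 0) ℕ.+ ∑ (slice h 1 N) f                ≡⟨ cong (λ xs → f (h 0) ℕ.+ ∑ xs f) (trans (slice-suc h 0 N) (slice-map (h ∘ suc) 0 N)) ⟩
    f (h 0) ℕ.+ ∑ (map (h ∘ suc) (slice id 0 N)) f ≡⟨ cong (f (h 0) ℕ.+_) (∑-map (h ∘ suc) (slice id 0 N) f) ⟩
    f (h 0) ℕ.+ ∑ (slice id 0 N) (f ∘ h ∘ suc)   ≤⟨ ℕP.+-monoˡ-≤ _ (⟦⟧≤1 (adj v (h 0))) ⟩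
    suc (∑ (slice id 0 N) (f ∘ h ∘ suc))         ∎
    where
    open ℕP.≤-Reasoning
    f : Fin (suc N) → ℕ
    f u = ⟦ adj v u ⟧

-- The loss of one neighbour is paid for by halving the density, once `N` is at least `2 * (d + 1)`.
density : ∀ d N x y → suc N ℕ.≤ suc d ℕ.* x → x ℕ.≤ suc y → suc (suc (d ℕ.+ d)) ℕ.≤ N →
          N ℕ.≤ suc (suc (d ℕ.+ d)) ℕ.* y
density d N x y n≤ x≤ big = +-cancelˡ-≤ N _ _ (begin
  N ℕ.+ N                                       ≤⟨ +-mono-≤ N≤ N≤ ⟩
  suc d ℕ.* suc y ℕ.+ suc d ℕ.* suc y           ≡⟨ lem d y ⟩
  suc (suc (d ℕ.+ d)) ℕ.+ suc (suc (d ℕ.+ d)) ℕ.* y ≤⟨ +-monoˡ-≤ _ big ⟩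
  N ℕ.+ suc (suc (d ℕ.+ d)) ℕ.* y               ∎)
  where
  open ℕP
  open ≤-Reasoning
  N≤ : N ℕ.≤ suc d ℕ.* suc y
  N≤ = ≤-trans (n≤1+n N) (≤-trans n≤ (*-monoʳ-≤ (suc d) x≤))
  lem : ∀ d y → suc d ℕ.* suc y ℕ.+ suc d ℕ.* suc y ≡ suc (suc (d ℕ.+ d)) ℕ.+ suc (suc (d ℕ.+ d)) ℕ.* y
  lem = solve 2 (λ d y → (con 1 :+ d) :* (con 1 :+ y) :+ (con 1 :+ d) :* (con 1 :+ y)
          := (con 2 :+ (d :+ d)) :+ (con 2 :+ (d :+ d)) :* y) refl where open +-*-Solver

-- A positive fraction with denominator `d + 1` is at least `1 / (d + 1)`.
rational-bound : ∀ ε → 0ℚ < ε → Σ ℕ λ d → ∀ n x → ε * (+ n / 1) ≤ (+ x) / 1 → n ℕ.≤ suc d ℕ.* x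
rational-bound (mkℚ (+ 0) _ _)      (*<* (+<+ ()))
rational-bound (mkℚ -[1+ _ ] _ _)   (*<* ())
rational-bound ε@(mkℚ (+ suc a) d _) _ = d , bound
  where
  bound : ∀ n x → ε * (+ n / 1) ≤ (+ x) / 1 → n ℕ.≤ suc d ℕ.* x
  bound n x le = begin
    n                  ≤⟨ m≤m+n n (a ℕ.* n) ⟩
    suc a ℕ.* n        ≡⟨ *-identityʳ _ ⟨
    suc a ℕ.* n ℕ.* 1  ≤⟨ ℤP.drop‿+≤+ (subst₂ ℤ._≤_ eqˡ eqʳ (ℚᵘP.drop-*≤* leᵘ)) ⟩
    x ℕ.* suc d        ≡⟨ *-comm x (suc d) ⟩
    suc d ℕ.* x        ∎
    where
    open ℕP
    open ≤-Reasoning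
    leᵘ : toℚᵘ ε ℚᵘ.* mkℚᵘ (+ n) 0 ℚᵘ.≤ mkℚᵘ (+ x) 0
    leᵘ = ℚᵘP.≤-respʳ-≃ (ℚP.toℚᵘ-fromℚᵘ (mkℚᵘ (+ x) 0))
      (ℚᵘP.≤-respˡ-≃ (ℚᵘP.≃-trans (ℚP.toℚᵘ-homo-* ε (+ n / 1))
        (ℚᵘP.*-congˡ {toℚᵘ ε} (ℚP.toℚᵘ-fromℚᵘ (mkℚᵘ (+ n) 0)))) (ℚP.toℚᵘ-mono-≤ le))
    eqˡ : (+ suc a ℤ.* + n) ℤ.* + 1 ≡ + (suc a ℕ.* n ℕ.* 1)
    eqˡ = trans (cong (ℤ._* + 1) (sym (ℤP.pos-* (suc a) n))) (sym (ℤP.pos-* (suc a ℕ.* n) 1))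
    eqʳ : + x ℤ.* + (suc d ℕ.* 1) ≡ + (x ℕ.* suc d)
    eqʳ = trans (sym (ℤP.pos-* x (suc d ℕ.* 1))) (cong (λ z → + (x ℕ.* z)) (*-identityʳ (suc d)))

module _ {n : ℕ} (G : Graph n) where

  consecutive-adj : ∀ d x xs z → ConsecAdj G (x ∷ xs ++ z ∷ []) → ∀ i → i ℕ.< length xs →
    Adj G (nth d (x ∷ xs) i) (nth d (x ∷ xs) (suc i))
  consecutive-adj d x (y ∷ xs) z (a , _)  zero    _  = a
  consecutive-adj d x (y ∷ xs) z (_ , as) (suc i) lt = consecutive-adj d y xs z as i (ℕP.≤-pred lt)

  last-adj : ∀ d x xs z → ConsecAdj G (x ∷ xs ++ z ∷ []) → Adj G (nth d (x ∷ xs) (length xs)) z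
  last-adj d x []       z (a , _)  = a
  last-adj d x (y ∷ xs) z (_ , as) = last-adj d y xs z as

theorem1p3 : (k : ℕ) → .{{_ : NonZero k}} → (ε : ℚ) → 0ℚ < ε →
    Σ ℕ λ N → (n : ℕ) → n ≥ N → (G : Graph n) → Hamiltonian G →
    ((v : Fin n) → ε * (+ n / 1) ≤ (+ deg G v) / 1) →
    TwoFactorWith G k
theorem1p3 zero {{k≢0}} = ⊥-elim (ℕ.≢-nonZero⁻¹ 0 {{k≢0}} refl)
theorem1p3 (suc k) ε ε>0 = from-density (rational-bound ε ε>0)
  where
  from-density : (Σ ℕ λ d → ∀ n x → ε * (+ n / 1) ≤ (+ x) / 1 → n ℕ.≤ suc d ℕ.* x) → _
  -- `blowup E` works with density `1 / (E + 1)`, here `1 / (2 * (d + 1))` as provided by `density`.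
  from-density (d , bound) = from-blowup (blowup (suc (d ℕ.+ d)))
    where
    from-blowup : (Σ ℕ λ Q → NonZero Q × (∀ m → Σ ℕ λ N₀ →
      ∀ (X : List ℕ) (R B : ℕ → ℕ → Bool) → N₀ ℕ.≤ length X →
      (∀ x → length X ℕ.≤ suc (suc (d ℕ.+ d)) ℕ.* ∑ X (⟦_⟧ ∘ R x)) →
      (∀ x → length X ℕ.≤ suc (suc (d ℕ.+ d)) ℕ.* ∑ X (⟦_⟧ ∘ B x)) → Blowup X R B Q (suc m))) →
      Σ ℕ λ N → (n : ℕ) → n ≥ N → (G : Graph n) → Hamiltonian G →
      ((v : Fin n) → ε * (+ n / 1) ≤ (+ deg G v) / 1) → TwoFactorWith G (suc k)
    -- There is one position fewer than there are vertices; `N₀` of them serve the blow-up and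
    -- `2 * (d + 1)` serve `density`. `Q` is a successor, so the walk can start at index `zero`.
    from-blowup (Q@(suc _) , _ , find) = suc (N₀ ℕ.+ suc (suc (d ℕ.+ d))) , go
      where
      m = suc k ℕ.* (Q ℕ.+ Q) ℕ.* 2 ℕ.* 2
      N₀ = proj₁ (find m)
      go : ∀ n → n ≥ suc (N₀ ℕ.+ suc (suc (d ℕ.+ d))) → (G : Graph n) → Hamiltonian G →
           ((v : Fin n) → ε * (+ n / 1) ≤ (+ deg G v) / 1) → TwoFactorWith G (suc k)
      go (suc N) (ℕ.s≤s big) G (v ∷ vs , (_ , _ , adjs) , perm) δ =
        Assembly.two-factor G h (λ i i<N → consecutive-adj G v v vs v adjs i (subst (i ℕ.<_) (sym |vs|) i<N))
          (subst (λ l → Adj G (h l) v) |vs| (last-adj G v v vs v adjs)) cover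
          (lookup Us) (lookup Vs) r b red blue k zero (stock Us-sub) (stock Vs-sub)
        where
        open Graph G using (adj)
        -- Indices up to `N` lie on the list; the default `v` occurs only beyond it.
        h = nth v (v ∷ vs)
        |vs| : length vs ≡ N
        |vs| = ℕP.suc-injective (trans (↭-length perm) (length-tabulate id))
        cover : slice h 0 (suc N) ↭ allFin (suc N)
        cover = ↭-trans (↭-reflexive (trans (cong (slice h 0 ∘ suc) (sym |vs|)) (slice-nth v (v ∷ vs)))) perm
        open HamiltonianCycle G h cover
        positions = slice id 0 N
        |positions| = length-slice id 0 N
        dense : ∀ v y → deg G v ℕ.≤ suc y → length positions ℕ.≤ suc (suc (d ℕ.+ d)) ℕ.* y
        dense v y le = subst (ℕ._≤ suc (suc (d ℕ.+ d)) ℕ.* y) (sym |positions|)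
          (density d N (deg G v) y (bound (suc N) (deg G v) (δ v)) le (ℕP.≤-trans (ℕP.m≤n+m _ N₀) big))
        open Blowup (proj₂ (find m) positions (λ p q → adj (h p) (h q)) (λ p q → adj (h (suc p)) (h (suc q)))
          (ℕP.≤-trans (ℕP.≤-trans (ℕP.m≤m+n N₀ _) big) (ℕP.≤-reflexive (sym |positions|)))
          (λ p → dense (h p) _ (deg-red (h p))) (λ p → dense (h (suc p)) _ (deg-blue (h (suc p)))))
        stock : ∀ {Ws} → VAll.All (λ W → W ⊆ positions × length W ≡ suc m) Ws → ∀ (i : Fin Q) →
          AllPairs ℕ._<_ (lookup Ws i) × All (ℕ._< N) (lookup Ws i) × m ℕ.≤ length (lookup Ws i)
        stock subs i = let sub , len = VAllP.lookup⁺ subs i in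
          AllPairs-resp-⊆ sub (slice-increasing 0 N) , All-resp-⊆ sub (slice-< 0 N) ,
          ℕP.≤-trans (ℕP.n≤1+n m) (ℕP.≤-reflexive (sym len))
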